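{- Let $p>5$ be a prime with $p\equiv 3\pmod 4$, and let $k\geq 1$ be an integer. For all integers $A\geq C\geq 1$ and $B\geq D\geq 1$, $$\mathcal R(p^kA,p^kB;p^kC,p^kD)\equiv \mathcal R(p^{k-1}A,p^{k-1}B;p^{k-1}C,p^{k-1}D)\pmod{p^{3k}}.$$
   Context: For integers $A\geq C\geq 1$ and $B\geq D\geq 1$, the rectangular Gaussian binomial coefficient is the element of $\mathbb Q(i)$ $$\mathcal R(A,B;C,D):=\frac{\prod_{n=0}^{C-1}\prod_{m=0}^{D-1}\bigl(A+Bi-(n+mi)\bigr)}{\prod_{n=1}^{C}\prod_{m=1}^{D}(n+mi)}=\frac{\prod_{x=A-C+1}^{A}\prod_{y=B-D+1}^{B}(x+iy)}{\prod_{x=1}^{C}\prod_{y=1}^{D}(x+iy)}.$$ For a prime $p\equiv 3\pmod 4$, $\mathbb Q(i)$ is viewed inside $\mathbb Q_p(i)$, the unramified quadratic extension of $\mathbb Q_p$, whose ring of integers is $\mathbb Z_p[i]$. Congruences are interpreted locally: $X\equiv Y\pmod{p^r}$ means $X-Y\in p^r\mathbb Z_p[i]$. -}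

module Defs where

open import Algebra.Bundles.Raw using (RawRing)
open import Data.Integer.Base as ℤ using (ℤ; +_)
import Data.Integer.Properties as ℤ
import Data.Integer.Solver as ℤ-Solver
open import Data.Integer.Divisibility.Signed
  using (_∣_; divides; ∣m∣n⇒∣m+n; ∣m⇒∣-m; ∣n⇒∣m*n; ∣m⇒∣m*n)
open import Data.Nat.Base as ℕ using (ℕ; zero; suc)
open import Data.Product.Base using (_×_; Σ-syntax)
open import Data.Rational.Base as ℚ using (ℚ; ↥_)
import Data.Rational.Properties as ℚ
import Data.Rational.Solver as ℚ-Solver
open import Level using (0ℓ)
open import Relation.Binary.PropositionalEquality
  using (_≡_; refl; sym; subst)

infix 5 _+i_

record _[i] (A : Set) : Set where
  constructor _+i_
  field
    re im : A

open _[i] public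

map-i : {A B : Set} → (A → B) → A [i] → B [i]
map-i f z = f (re z) +i f (im z)

-- R[i] = R[t]/(t² + 1).
adjoin-i : RawRing 0ℓ 0ℓ → RawRing 0ℓ 0ℓ
adjoin-i R = record
  { Carrier = Carrier [i]
  ; _≈_     = λ z w → re z ≈ re w × im z ≈ im w
  ; _+_     = λ z w → (re z + re w) +i (im z + im w)
  ; _*_     = λ z w → (re z * re w + - (im z * im w)) +i (re z * im w + im z * re w)
  ; -_      = λ z → (- re z) +i (- im z)
  ; 0#      = 0# +i 0#
  ; 1#      = 1# +i 0#
  }
  where open RawRing R

------------------------------------------------------------------------
-- The field ℚ(i)

module ℚ⟨i⟩ where

  open RawRing (adjoin-i ℚ.+-*-rawRing) public

  infixl 6 _-_
  _-_ : Carrier → Carrier → Carrier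
  z - w = z + - w

  conj : Carrier → Carrier
  conj z = re z +i (ℚ.- im z)

  norm : Carrier → ℚ
  norm z = re z ℚ.* re z ℚ.+ im z ℚ.* im z

  -- Over ℚ, the norm of w is nonzero exactly when w is nonzero.
  infixl 7 _÷_
  _÷_ : (z w : Carrier) .{{_ : ℚ.NonZero (norm w)}} → Carrier
  z ÷ w = z * (map-i (ℚ._* (ℚ.1/ norm w)) (conj w))

  gaussian : ℕ → ℕ → Carrier
  gaussian n m = (+ n ℚ./ 1) +i (+ m ℚ./ 1)

  -- ∏ n f = f 0 * f 1 * … * f (n - 1)
  ∏ : ℕ → (ℕ → Carrier) → Carrier
  ∏ zero    f = 1#
  ∏ (suc n) f = ∏ n f * f n

  norm-* : ∀ z w → norm (z * w) ≡ norm z ℚ.* norm w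
  norm-* (a +i b) (c +i d) =
    solve 4 (λ a b c d →
      (a :* c :+ :- (b :* d)) :* (a :* c :+ :- (b :* d)) :+
      (a :* d :+ b :* c) :* (a :* d :+ b :* c)
      := (a :* a :+ b :* b) :* (c :* c :+ d :* d)) refl a b c d
    where open ℚ-Solver.+-*-Solver

  norm-∏-pos : ∀ n {f} → (∀ x → ℚ.Positive (norm (f x))) → ℚ.Positive (norm (∏ n f))
  norm-∏-pos zero        pos = _
  norm-∏-pos (suc n) {f} pos = subst ℚ.Positive (sym (norm-* (∏ n f) (f n)))
    (ℚ.pos*pos⇒pos (norm (∏ n f)) {{norm-∏-pos n pos}} (norm (f n)) {{pos n}})

  norm-gaussian-pos : ∀ n m → ℚ.Positive (norm (gaussian (suc n) (suc m)))
  norm-gaussian-pos n m = ℚ.pos+pos⇒pos (sq n) {{sq-pos n}} (sq m) {{sq-pos m}}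
    where
    q : ℕ → ℚ
    q n = + suc n ℚ./ 1

    sq : ℕ → ℚ
    sq n = q n ℚ.* q n

    q-pos : ∀ n → ℚ.Positive (q n)
    q-pos n = ℚ.normalize-pos (suc n) 1

    sq-pos : ∀ n → ℚ.Positive (sq n)
    sq-pos n = ℚ.pos*pos⇒pos (q n) {{q-pos n}} (q n) {{q-pos n}}

open ℚ⟨i⟩ using (gaussian; ∏; norm; _÷_)

------------------------------------------------------------------------
-- The rectangular Gaussian binomial coefficient

numerator : (A B C D : ℕ) → ℚ [i]
numerator A B C D = ∏ C λ n → ∏ D λ m → gaussian A B ℚ⟨i⟩.- gaussian n m

denominator : (C D : ℕ) → ℚ [i]
denominator C D = ∏ C λ n → ∏ D λ m → gaussian (suc n) (suc m)

denominator-nonZero : ∀ C D → ℚ.NonZero (norm (denominator C D))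
denominator-nonZero C D = ℚ.pos⇒nonZero (norm (denominator C D))
  {{ℚ⟨i⟩.norm-∏-pos C λ n → ℚ⟨i⟩.norm-∏-pos D λ m → ℚ⟨i⟩.norm-gaussian-pos n m}}

𝓡 : (A B C D : ℕ) → ℚ [i]
𝓡 A B C D = (numerator A B C D ÷ denominator C D) {{denominator-nonZero C D}}

------------------------------------------------------------------------
-- ℤₚ is the inverse limit of the rings ℤ/pⁿℤ, and ℚₚ its localisation at
-- the positive integers.

module Padic (p : ℕ) where

  record ℤₚ : Set where
    constructor mkℤₚ
    field
      residue  : ℕ → ℤ
      coherent : ∀ n → + (p ℕ.^ n) ∣ residue (suc n) ℤ.- residue n

  open ℤₚ public

  private
    *-coherent : ∀ {d} a a′ b b′ → d ∣ a′ ℤ.- a → d ∣ b′ ℤ.- b →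
                 d ∣ a′ ℤ.* b′ ℤ.- a ℤ.* b
    *-coherent a a′ b b′ d∣a d∣b = subst (_ ∣_)
      (solve 4 (λ a a′ b b′ →
        (a′ :- a) :* b′ :+ a :* (b′ :- b) := a′ :* b′ :- a :* b) refl a a′ b b′)
      (∣m∣n⇒∣m+n (∣m⇒∣m*n b′ d∣a) (∣n⇒∣m*n a d∣b))
      where open ℤ-Solver.+-*-Solver

    +-coherent : ∀ {d} a a′ b b′ → d ∣ a′ ℤ.- a → d ∣ b′ ℤ.- b →
                 d ∣ (a′ ℤ.+ b′) ℤ.- (a ℤ.+ b)
    +-coherent a a′ b b′ d∣a d∣b = subst (_ ∣_)
      (solve 4 (λ a a′ b b′ →
        (a′ :- a) :+ (b′ :- b) := (a′ :+ b′) :- (a :+ b)) refl a a′ b b′)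
      (∣m∣n⇒∣m+n d∣a d∣b)
      where open ℤ-Solver.+-*-Solver

    neg-coherent : ∀ {d} a a′ → d ∣ a′ ℤ.- a → d ∣ (ℤ.- a′) ℤ.- (ℤ.- a)
    neg-coherent a a′ d∣a = subst (_ ∣_)
      (solve 2 (λ a a′ → :- (a′ :- a) := (:- a′) :- (:- a)) refl a a′)
      (∣m⇒∣-m d∣a)
      where open ℤ-Solver.+-*-Solver

  ℤ→ℤₚ : ℤ → ℤₚ
  ℤ→ℤₚ a = mkℤₚ (λ _ → a) (λ _ → divides (+ 0) (ℤ.+-inverseʳ a))

  ℤₚ-rawRing : RawRing 0ℓ 0ℓ
  ℤₚ-rawRing = record
    { Carrier = ℤₚ
    ; _≈_     = λ x y → ∀ n → + (p ℕ.^ n) ∣ residue x n ℤ.- residue y n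
    ; _+_     = λ x y → mkℤₚ (λ n → residue x n ℤ.+ residue y n) λ n →
        +-coherent (residue x n) (residue x (suc n)) (residue y n) (residue y (suc n))
                   (coherent x n) (coherent y n)
    ; _*_     = λ x y → mkℤₚ (λ n → residue x n ℤ.* residue y n) λ n →
        *-coherent (residue x n) (residue x (suc n)) (residue y n) (residue y (suc n))
                   (coherent x n) (coherent y n)
    ; -_      = λ x → mkℤₚ (λ n → ℤ.- residue x n) λ n →
        neg-coherent (residue x n) (residue x (suc n)) (coherent x n)
    ; 0#      = ℤ→ℤₚ (+ 0)
    ; 1#      = ℤ→ℤₚ (+ 1)
    }

  private module Z = RawRing ℤₚ-rawRing

  -- The fraction num / (1 + den-1).
  record ℚₚ : Set where
    constructor mkℚₚ
    field
      num   : ℤₚ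
      den-1 : ℕ

    denₙ : ℕ
    denₙ = suc den-1

    den : ℤₚ
    den = ℤ→ℤₚ (+ denₙ)

  open ℚₚ public

  ℤₚ→ℚₚ : ℤₚ → ℚₚ
  ℤₚ→ℚₚ x = mkℚₚ x 0

  ℚ→ℚₚ : ℚ → ℚₚ
  ℚ→ℚₚ q = mkℚₚ (ℤ→ℤₚ (↥ q)) (ℚ.denominator-1 q)

  ℚₚ-rawRing : RawRing 0ℓ 0ℓ
  ℚₚ-rawRing = record
    { Carrier = ℚₚ
    ; _≈_     = λ x y → num x Z.* den y Z.≈ num y Z.* den x
    ; _+_     = λ x y → mkℚₚ (num x Z.* den y Z.+ num y Z.* den x)
                             (ℕ.pred (denₙ x ℕ.* denₙ y))
    ; _*_     = λ x y → mkℚₚ (num x Z.* num y) (ℕ.pred (denₙ x ℕ.* denₙ y))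
    ; -_      = λ x → mkℚₚ (Z.- num x) (den-1 x)
    ; 0#      = ℤₚ→ℚₚ Z.0#
    ; 1#      = ℤₚ→ℚₚ Z.1#
    }

  private
    module Zi = RawRing (adjoin-i ℤₚ-rawRing)
    module Qi = RawRing (adjoin-i ℚₚ-rawRing)

  -- X - Y ∈ pʳℤₚ[i], where ℚ(i) and ℤₚ[i] are viewed inside ℚₚ(i).
  infix 4 _≡_[mod-p^_]
  _≡_[mod-p^_] : ℚ [i] → ℚ [i] → ℕ → Set
  X ≡ Y [mod-p^ r ] = Σ[ z ∈ ℤₚ [i] ]
    map-i ℚ→ℚₚ X Qi.+ (Qi.- map-i ℚ→ℚₚ Y)
      Qi.≈ map-i ℤₚ→ℚₚ ((ℤ→ℤₚ (+ (p ℕ.^ r)) +i Z.0#) Zi.* z)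

{-# OPTIONS --safe #-}
module Submission where

-- Since p ≡ 3 (mod 4) is inert in ℤ[i], x + iy is a unit modulo p unless p divides both x and y.
-- The factors divisible by p reproduce p to a power times the products at level k - 1, so with
-- n = pᵏ the claim reduces to the product of the units among the nw + u, u running over a
-- rectangle, being independent of w modulo n³.  The rectangle is a union of n × n squares, and
-- each square [1, n]² splits into its interior and two edges.
--
-- The quarter turn u ↦ n + iu permutes the interior, and the product of (nw + u) over an orbit
-- is a polynomial in nw that is constant modulo n⁴; hence the fourth power of the interior
-- product is independent of w, and so is the product itself, because it is a unit and is
-- constant modulo n.  On an edge the reflection j ↦ n - j gives factors ε + j(n - j) with n²
-- dividing ε (up to a unit), and doubling, which permutes the residues modulo n, plays the role
-- of Wolstenholme's ∑ j⁻² ≡ 0 (mod n).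
--
-- The integrality needed to multiply the congruence of units by the coefficient at level k - 1
-- comes from comparing the number of multiples of p in a C × D rectangle with ⌊C/p⌋ ⌊D/p⌋.

open import Defs
open import Algebra.Bundles using (CommutativeRing)
open import Algebra.Bundles.Raw using (RawRing)
open import Algebra.Structures using (IsCommutativeRing)
import Algebra.Properties.CommutativeSemigroup as CommutativeSemigroupProperties
import Algebra.Properties.Ring as RingProperties
import Algebra.Solver.Ring as RingSolver
import Algebra.Solver.Ring.AlmostCommutativeRing as ACR
import Algebra.Solver.Ring.NaturalCoefficients.Default as NaturalSolver
open import Data.Bool.Base using (if_then_else_)
open import Data.Integer.Base as ℤ using (ℤ; +_)
import Data.Integer.Divisibility.Signed as ℤ∣
import Data.Integer.DivMod as ℤ
import Data.Integer.Properties as ℤ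
import Data.Integer.Solver as ℤ-Solver
open import Data.Maybe.Base using (Maybe)
open import Data.Nat.Base as ℕ using (ℕ; zero; suc; _<_; _≤_)
open import Data.Nat.Coprimality using (Coprime; coprime-Bézout)
open import Data.Nat.Divisibility as ℕ using (_∣_; _∣?_)
import Data.Nat.DivMod as ℕ
open import Data.Nat.GCD using (module Bézout)
open import Data.Nat.Induction using (<-rec)
open import Data.Nat.Primality using (Prime; euclidsLemma; prime⇒irreducible)
import Data.Nat.Properties as ℕ
open import Data.Nat.Tactic.RingSolver using (solve-∀)
open import Data.Product.Base using (_×_; _,_; proj₁; proj₂; Σ-syntax)
open import Data.Rational.Base as ℚ using (ℚ; ↥_; ↧_)
import Data.Rational.Properties as ℚ
import Data.Rational.Solver as ℚ-Solver
import Data.Rational.Unnormalised.Base as ℚᵘ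
import Data.Rational.Unnormalised.Properties as ℚᵘ
open import Data.Sum.Base using (_⊎_; inj₁; inj₂)
open import Function.Base using (_∘_)
open import Level using (0ℓ)
open import Relation.Binary.Bundles using (Setoid)
open import Relation.Binary.Definitions using (Decidable)
open import Relation.Binary.PropositionalEquality
  using (_≡_; refl; sym; trans; cong; cong₂; subst; subst₂; isEquivalence; module ≡-Reasoning)
import Relation.Binary.Reasoning.Setoid as SetoidReasoning
open import Relation.Nullary using (Dec; does; yes; no; ¬_; contradiction)
open import Relation.Nullary.Decidable using (map′; _×-dec_; dec⇒maybe)

-- Adjoining a square root of -1 to a commutative ring.

module Adjoin {A : Set} {add mul : A → A → A} {neg : A → A} {zero one : A}
  (isCommutativeRing : IsCommutativeRing _≡_ add mul neg zero one)
  (_≟_ : Decidable {A = A} _≡_) where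

  private
    R : CommutativeRing 0ℓ 0ℓ
    R = record { isCommutativeRing = isCommutativeRing }

    module R = CommutativeRing R

  open NaturalSolver R.commutativeSemiring
  open RingProperties R.ring using (-1*x≈-x)
  open RawRing (adjoin-i R.rawRing)

  commutativeRing : CommutativeRing 0ℓ 0ℓ
  commutativeRing = record
    { Carrier = Carrier
    ; _≈_     = _≡_
    ; _+_     = _+_
    ; _*_     = _*_
    ; -_      = -_
    ; 0#      = 0#
    ; 1#      = 1#
    ; isCommutativeRing = record
      { isRing = record
        { +-isAbelianGroup = record
          { isGroup = record
            { isMonoid = record
              { isSemigroup = record
                { isMagma = record { isEquivalence = isEquivalence ; ∙-cong = cong₂ _+_ }
                ; assoc   = λ z w v → cong₂ _+i_ (R.+-assoc (re z) (re w) (re v))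
                                                 (R.+-assoc (im z) (im w) (im v))
                }
              ; identity = (λ z → cong₂ _+i_ (R.+-identityˡ (re z)) (R.+-identityˡ (im z)))
                         , (λ z → cong₂ _+i_ (R.+-identityʳ (re z)) (R.+-identityʳ (im z)))
              }
            ; inverse = (λ z → cong₂ _+i_ (R.-‿inverseˡ (re z)) (R.-‿inverseˡ (im z)))
                      , (λ z → cong₂ _+i_ (R.-‿inverseʳ (re z)) (R.-‿inverseʳ (im z)))
            ; ⁻¹-cong = cong -_
            }
          ; comm = λ z w → cong₂ _+i_ (R.+-comm (re z) (re w)) (R.+-comm (im z) (im w))
          }
        ; *-cong     = cong₂ _*_
        ; *-assoc    = *-assoc
        ; *-identity = *-identityˡ , λ z → trans (*-comm z 1#) (*-identityˡ z)
        ; distrib    = distribˡ , λ z w v → trans (*-comm (w + v) z)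
                         (trans (distribˡ z w v) (cong₂ _+_ (*-comm z w) (*-comm z v)))
        }
      ; *-comm = *-comm
      }
    }
    where
    -- With -1 as a variable the ring laws become semiring identities.
    -≡-1* : ∀ x → neg x ≡ mul (neg one) x
    -≡-1* x = sym (-1*x≈-x x)

    *-comm : ∀ z w → z * w ≡ w * z
    *-comm (a +i b) (c +i d) = cong₂ _+i_
      (cong₂ (λ x y → add x (neg y)) (R.*-comm a c) (R.*-comm b d))
      (solve 4 (λ a b c d → a :* d :+ b :* c := c :* b :+ d :* a) refl a b c d)

    *-assoc : ∀ z w v → (z * w) * v ≡ z * (w * v)
    *-assoc (a +i b) (c +i d) (e +i f)
      rewrite -≡-1* (mul b d) | -≡-1* (mul d f)
            | -≡-1* (mul (add (mul a d) (mul b c)) f)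
            | -≡-1* (mul b (add (mul c f) (mul d e))) = cong₂ _+i_
      (solve 7 (λ a b c d e f m →
        (a :* c :+ m :* (b :* d)) :* e :+ m :* ((a :* d :+ b :* c) :* f) :=
        a :* (c :* e :+ m :* (d :* f)) :+ m :* (b :* (c :* f :+ d :* e))) refl a b c d e f (neg one))
      (solve 7 (λ a b c d e f m →
        (a :* c :+ m :* (b :* d)) :* f :+ (a :* d :+ b :* c) :* e :=
        a :* (c :* f :+ d :* e) :+ b :* (c :* e :+ m :* (d :* f))) refl a b c d e f (neg one))

    *-identityˡ : ∀ z → 1# * z ≡ z
    *-identityˡ (a +i b) rewrite -≡-1* (mul zero b) = cong₂ _+i_
      (solve 3 (λ a b m → con 1 :* a :+ m :* (con 0 :* b) := a) refl a b (neg one))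
      (solve 2 (λ a b → con 1 :* b :+ con 0 :* a := b) refl a b)

    distribˡ : ∀ z w v → z * (w + v) ≡ z * w + z * v
    distribˡ (a +i b) (c +i d) (e +i f)
      rewrite -≡-1* (mul b d) | -≡-1* (mul b f) | -≡-1* (mul b (add d f)) = cong₂ _+i_
      (solve 7 (λ a b c d e f m → a :* (c :+ e) :+ m :* (b :* (d :+ f)) :=
        (a :* c :+ m :* (b :* d)) :+ (a :* e :+ m :* (b :* f))) refl a b c d e f (neg one))
      (solve 6 (λ a b c d e f → a :* (d :+ f) :+ b :* (c :+ e) :=
        (a :* d :+ b :* c) :+ (a :* f :+ b :* e)) refl a b c d e f)

  _≟ᵢ_ : Decidable {A = Carrier} _≡_
  (a +i b) ≟ᵢ (c +i d) =
    map′ (λ (p , q) → cong₂ _+i_ p q) (λ eq → cong re eq , cong im eq) (a ≟ c ×-dec b ≟ d)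

-- Arithmetic of the Gaussian integers.

module Gaussian where

  private module ℤ[i]-raw = RawRing (adjoin-i ℤ.+-*-rawRing)

  infixl 7 _*_
  infixl 6 _+_
  infix  8 -_

  0# 1# : ℤ [i]
  0# = + 0 +i + 0
  1# = + 1 +i + 0

  -- Kept opaque so that ring expressions do not unfold into their integer coordinates.
  opaque
    _+_ _*_ : ℤ [i] → ℤ [i] → ℤ [i]
    _+_ = ℤ[i]-raw._+_
    _*_ = ℤ[i]-raw._*_

    -_ : ℤ [i] → ℤ [i]
    -_ = ℤ[i]-raw.-_

    ℤ[i]-isCommutativeRing : IsCommutativeRing _≡_ _+_ _*_ -_ 0# 1#
    ℤ[i]-isCommutativeRing =
      CommutativeRing.isCommutativeRing (Adjoin.commutativeRing ℤ.+-*-isCommutativeRing ℤ._≟_)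

  ℤ[i] : CommutativeRing 0ℓ 0ℓ
  ℤ[i] = record { isCommutativeRing = ℤ[i]-isCommutativeRing }

  ℚ[i] : CommutativeRing 0ℓ 0ℓ
  ℚ[i] = Adjoin.commutativeRing ℚ.+-*-isCommutativeRing ℚ._≟_

  private
    opaque
      unfolding _+_ _*_ -_

      +-raw : ∀ z w → z ℤ[i]-raw.+ w ≡ z + w
      +-raw _ _ = refl

      *-raw : ∀ z w → z ℤ[i]-raw.* w ≡ z * w
      *-raw _ _ = refl

      -‿raw : ∀ z → ℤ[i]-raw.- z ≡ - z
      -‿raw _ = refl

    -- The solver evaluates its coefficients with the transparent copy of the opaque operations.
    literals : adjoin-i ℤ.+-*-rawRing ACR.-Raw-AlmostCommutative⟶ ACR.fromCommutativeRing ℤ[i]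
    literals = record
      { ⟦_⟧    = λ z → z
      ; +-homo = +-raw
      ; *-homo = *-raw
      ; -‿homo = -‿raw
      ; 0-homo = refl
      ; 1-homo = refl
      }

    maybe-≟ : ∀ z w → Maybe (z ≡ w)
    maybe-≟ z w = dec⇒maybe (Adjoin._≟ᵢ_ ℤ.+-*-isCommutativeRing ℤ._≟_ z w)

  module ℤ[i]-Solver = RingSolver (adjoin-i ℤ.+-*-rawRing) (ACR.fromCommutativeRing ℤ[i]) literals maybe-≟

  open CommutativeRing ℤ[i] public
    using (_-_; +-identityˡ; *-assoc; *-comm; *-identityˡ; *-identityʳ; zeroʳ)
  open CommutativeSemigroupProperties (CommutativeRing.*-commutativeSemigroup ℤ[i]) using (interchange)
  open ℤ[i]-Solver
  private module S = ℤ-Solver.+-*-Solver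

  -- Finite products in ℤ[i]

  ∏ : ℕ → (ℕ → ℤ [i]) → ℤ [i]
  ∏ zero    f = 1#
  ∏ (suc n) f = ∏ n f * f n

  ∏-cong : ∀ n {f g} → (∀ j → j < n → f j ≡ g j) → ∏ n f ≡ ∏ n g
  ∏-cong zero    eq = refl
  ∏-cong (suc n) eq = cong₂ _*_ (∏-cong n λ j j<n → eq j (ℕ.m<n⇒m<1+n j<n)) (eq n ℕ.≤-refl)

  ∏-cong₂ : ∀ m n {f g : ℕ → ℕ → ℤ [i]} → (∀ j k → j < m → k < n → f j k ≡ g j k) →
            ∏ m (λ j → ∏ n (f j)) ≡ ∏ m (λ j → ∏ n (g j))
  ∏-cong₂ m n eq = ∏-cong m λ j j<m → ∏-cong n λ k k<n → eq j k j<m k<n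

  ∏-1 : ∀ n {f} → (∀ j → j < n → f j ≡ 1#) → ∏ n f ≡ 1#
  ∏-1 zero    eq = refl
  ∏-1 (suc n) eq = trans (cong₂ _*_ (∏-1 n λ j j<n → eq j (ℕ.m<n⇒m<1+n j<n)) (eq n ℕ.≤-refl))
                         (*-identityˡ 1#)

  ∏-* : ∀ n f g → ∏ n (λ j → f j * g j) ≡ ∏ n f * ∏ n g
  ∏-* zero    f g = sym (*-identityˡ 1#)
  ∏-* (suc n) f g = trans (cong (_* (f n * g n)) (∏-* n f g)) (interchange (∏ n f) (∏ n g) (f n) (g n))

  ∏-*₂ : ∀ m n (f g : ℕ → ℕ → ℤ [i]) → ∏ m (λ j → ∏ n λ k → f j k * g j k) ≡
                     ∏ m (λ j → ∏ n (f j)) * ∏ m (λ j → ∏ n (g j))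
  ∏-*₂ m n f g = trans (∏-cong m λ j _ → ∏-* n (f j) (g j)) (∏-* m (λ j → ∏ n (f j)) (λ j → ∏ n (g j)))

  ∏-comm : ∀ m n (f : ℕ → ℕ → ℤ [i]) → ∏ m (λ j → ∏ n (f j)) ≡ ∏ n (λ k → ∏ m λ j → f j k)
  ∏-comm zero    n f = sym (∏-1 n {λ _ → 1#} λ _ _ → refl)
  ∏-comm (suc m) n f = trans (cong (_* ∏ n (f m)) (∏-comm m n f)) (sym (∏-* n (λ k → ∏ m λ j → f j k) (f m)))

  ∏-+ : ∀ m n f → ∏ (m ℕ.+ n) f ≡ ∏ m f * ∏ n (λ j → f (m ℕ.+ j))
  ∏-+ m zero f rewrite ℕ.+-identityʳ m = sym (*-identityʳ (∏ m f))
  ∏-+ m (suc n) f rewrite ℕ.+-suc m n =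
    trans (cong (_* f (m ℕ.+ n)) (∏-+ m n f)) (*-assoc (∏ m f) _ (f (m ℕ.+ n)))

  ∏-blocks : ∀ m n f → ∏ (m ℕ.* n) f ≡ ∏ m (λ c → ∏ n λ j → f (c ℕ.* n ℕ.+ j))
  ∏-blocks zero    n f = refl
  ∏-blocks (suc m) n f rewrite ℕ.+-comm n (m ℕ.* n) =
    trans (∏-+ (m ℕ.* n) n f) (cong (_* ∏ n (λ j → f (m ℕ.* n ℕ.+ j))) (∏-blocks m n f))

  ∏-head : ∀ n f → ∏ (suc n) f ≡ f 0 * ∏ n (f ∘ suc)
  ∏-head n f = trans (∏-+ 1 n f) (cong (_* ∏ n (f ∘ suc)) (*-identityˡ (f 0)))

  -- Mirror indices are related by the equation j + k + 1 = n, which keeps truncated subtraction out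
  -- of the hypothesis.
  ∏-reflect : ∀ n f g → (∀ j k → suc (j ℕ.+ k) ≡ n → f j ≡ g k) → ∏ n f ≡ ∏ n g
  ∏-reflect zero    f g eq = refl
  ∏-reflect (suc n) f g eq = begin
    ∏ n f * f n          ≡⟨ cong₂ _*_ (∏-reflect n f (g ∘ suc) λ j k e →
                              eq j (suc k) (cong suc (trans (ℕ.+-suc j k) e)))
                            (eq n 0 (cong suc (ℕ.+-identityʳ n))) ⟩
    ∏ n (g ∘ suc) * g 0  ≡⟨ *-comm _ (g 0) ⟩
    g 0 * ∏ n (g ∘ suc)  ≡⟨ ∏-head n g ⟨
    ∏ (suc n) g          ∎
    where open ≡-Reasoning

  ∏-parity : ∀ h f → ∏ (h ℕ.+ h) f ≡ ∏ h (λ j → f (j ℕ.+ j)) * ∏ h (λ j → f (suc (j ℕ.+ j)))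
  ∏-parity zero    f = sym (*-identityˡ 1#)
  ∏-parity (suc h) f rewrite ℕ.+-suc h h = trans
    (cong (λ z → z * f (h ℕ.+ h) * f (suc (h ℕ.+ h))) (∏-parity h f))
    (solve 4 (λ a b c d → a :* b :* c :* d := (a :* c) :* (b :* d)) refl _ _ _ _)

  -- Doubling permutes the residues modulo an odd number.
  ∏-double : ∀ h f → let n = suc (h ℕ.+ h) in (∀ j → f (n ℕ.+ j) ≡ f j) →
             ∏ n (λ j → f (j ℕ.+ j)) ≡ ∏ n f
  ∏-double h f periodic = begin
    ∏ (suc h ℕ.+ h) (λ j → f (j ℕ.+ j))
      ≡⟨ ∏-+ (suc h) h _ ⟩
    ∏ (suc h) (λ j → f (j ℕ.+ j)) * ∏ h (λ j → f ((suc h ℕ.+ j) ℕ.+ (suc h ℕ.+ j)))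
      -- In the upper half the doubled index wraps around: 2(h + 1 + j) = n + (2j + 1), so
      -- periodicity yields exactly the odd residues.
      ≡⟨ cong (λ z → evens * f (h ℕ.+ h) * z) (∏-cong h λ j _ → trans (cong f (shift j)) (periodic (suc (j ℕ.+ j)))) ⟩
    evens * f (h ℕ.+ h) * odds
      ≡⟨ solve 3 (λ a b c → a :* b :* c := a :* c :* b) refl evens (f (h ℕ.+ h)) odds ⟩
    evens * odds * f (h ℕ.+ h)
      ≡⟨ cong (_* f (h ℕ.+ h)) (∏-parity h f) ⟨
    ∏ (h ℕ.+ h) f * f (h ℕ.+ h) ∎
    where
    open ≡-Reasoning
    evens = ∏ h (λ j → f (j ℕ.+ j))
    odds  = ∏ h (λ j → f (suc (j ℕ.+ j)))

    shift : ∀ j → (suc h ℕ.+ j) ℕ.+ (suc h ℕ.+ j) ≡ suc (h ℕ.+ h) ℕ.+ suc (j ℕ.+ j)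
    shift j = cong suc (begin
      (h ℕ.+ j) ℕ.+ suc (h ℕ.+ j)   ≡⟨ ℕ.+-suc (h ℕ.+ j) (h ℕ.+ j) ⟩
      suc ((h ℕ.+ j) ℕ.+ (h ℕ.+ j)) ≡⟨ cong suc (+-interchange h j h j) ⟩
      suc ((h ℕ.+ h) ℕ.+ (j ℕ.+ j)) ≡⟨ ℕ.+-suc (h ℕ.+ h) (j ℕ.+ j) ⟨
      (h ℕ.+ h) ℕ.+ suc (j ℕ.+ j)   ∎)
      where open CommutativeSemigroupProperties ℕ.+-commutativeSemigroup
              using () renaming (interchange to +-interchange)

  -- Congruences and units modulo an element of ℤ[i]

  infix 4 _≈_mod_

  record _≈_mod_ (z w d : ℤ [i]) : Set where
    constructor by
    field
      quotient : ℤ [i]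
      equality : z ≡ w + d * quotient

  ≈-reflexive : ∀ {d z w} → z ≡ w → z ≈ w mod d
  ≈-reflexive {d} {z} refl = by 0# (solve 2 (λ z d → z := z :+ d :* con 0#) refl z d)

  ≈-refl : ∀ {d z} → z ≈ z mod d
  ≈-refl = ≈-reflexive refl

  ≈-sym : ∀ {d z w} → z ≈ w mod d → w ≈ z mod d
  ≈-sym {d} {w = w} (by q refl) = by (- q) (solve 3 (λ w d q → w := w :+ d :* q :+ d :* :- q) refl w d q)

  ≈-trans : ∀ {d z w v} → z ≈ w mod d → w ≈ v mod d → z ≈ v mod d
  ≈-trans {d} {v = v} (by q refl) (by r refl) =
    by (r + q) (solve 4 (λ v d q r → v :+ d :* r :+ d :* q := v :+ d :* (r :+ q)) refl v d q r)

  ≈-setoid : ℤ [i] → Setoid 0ℓ 0ℓ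
  ≈-setoid d = record
    { Carrier = ℤ [i]
    ; _≈_ = λ z w → z ≈ w mod d
    ; isEquivalence = record { refl = ≈-refl ; sym = ≈-sym ; trans = ≈-trans }
    }

  ≈-* : ∀ {d z w z′ w′} → z ≈ w mod d → z′ ≈ w′ mod d → z * z′ ≈ w * w′ mod d
  ≈-* {d} {w = w} {w′ = v} (by q refl) (by r refl) = by (q * v + w * r + d * q * r)
    (solve 5 (λ w v d q r → (w :+ d :* q) :* (v :+ d :* r) :=
      w :* v :+ d :* (q :* v :+ w :* r :+ d :* q :* r)) refl w v d q r)

  ≈-+ : ∀ {d z w z′ w′} → z ≈ w mod d → z′ ≈ w′ mod d → z + z′ ≈ w + w′ mod d
  ≈-+ {d} {w = w} {w′ = v} (by q refl) (by r refl) = by (q + r)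
    (solve 5 (λ w v d q r → (w :+ d :* q) :+ (v :+ d :* r) := w :+ v :+ d :* (q :+ r)) refl w v d q r)

  ≈-neg : ∀ {d z w} → z ≈ w mod d → - z ≈ - w mod d
  ≈-neg {d} {w = w} (by q refl) = by (- q)
    (solve 3 (λ w d q → :- (w :+ d :* q) := :- w :+ d :* :- q) refl w d q)

  ∏-≈ : ∀ {d} n {f g} → (∀ j → j < n → f j ≈ g j mod d) → ∏ n f ≈ ∏ n g mod d
  ∏-≈ zero    eq = ≈-refl
  ∏-≈ (suc n) eq = ≈-* (∏-≈ n λ j j<n → eq j (ℕ.m<n⇒m<1+n j<n)) (eq n ℕ.≤-refl)

  Unit : ℤ [i] → ℤ [i] → Set
  Unit d z = Σ[ v ∈ ℤ [i] ] z * v ≈ 1# mod d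

  Unit-1 : ∀ {d} → Unit d 1#
  Unit-1 = 1# , ≈-reflexive (*-identityˡ 1#)

  Unit-* : ∀ {d z w} → Unit d z → Unit d w → Unit d (z * w)
  Unit-* {d} {z} {w} (z′ , zz′) (w′ , ww′) = z′ * w′ ,
    ≈-trans (≈-reflexive (interchange z w z′ w′))
            (≈-trans (≈-* zz′ ww′) (≈-reflexive (*-identityˡ 1#)))

  Unit-resp : ∀ {d z w} → z ≈ w mod d → Unit d w → Unit d z
  Unit-resp z≈w (v , wv) = v , ≈-trans (≈-* z≈w ≈-refl) wv

  Unit-neg : ∀ {d z} → Unit d z → Unit d (- z)
  Unit-neg {z = z} (v , zv) = - v , ≈-trans (≈-reflexive
    (solve 2 (λ z v → :- z :* :- v := z :* v) refl z v)) zv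

  Unit-factor : ∀ {d} z {w} → Unit d (z * w) → Unit d z
  Unit-factor z {w} (v , zwv) = w * v , ≈-trans (≈-reflexive (sym (*-assoc z w v))) zwv

  Unit-∏ : ∀ {d} n {f} → (∀ j → j < n → Unit d (f j)) → Unit d (∏ n f)
  Unit-∏ zero    unit = Unit-1
  Unit-∏ (suc n) unit = Unit-* (Unit-∏ n λ j j<n → unit j (ℕ.m<n⇒m<1+n j<n)) (unit n ℕ.≤-refl)

  -- 1 - z (v + v′ - z v v′) = (1 - z v) (1 - z v′)
  Unit-mod-* : ∀ {d e z} → Unit d z → Unit e z → Unit (d * e) z
  Unit-mod-* {d} {e} {z} (v , by s zv) (v′ , by t zv′) = v + v′ - z * v * v′ , by (- (s * t)) (begin
    z * (v + v′ - z * v * v′)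
      ≡⟨ solve 3 (λ z v v′ → z :* (v :+ v′ :- z :* v :* v′) :=
           z :* v :+ z :* v′ :- z :* v :* (z :* v′)) refl z v v′ ⟩
    z * v + z * v′ - z * v * (z * v′)
      ≡⟨ cong₂ (λ x y → x + y - x * y) zv zv′ ⟩
    (1# + d * s) + (1# + e * t) - (1# + d * s) * (1# + e * t)
      ≡⟨ solve 4 (λ d e s t → (con 1# :+ d :* s) :+ (con 1# :+ e :* t) :-
           (con 1# :+ d :* s) :* (con 1# :+ e :* t) := con 1# :+ d :* e :* :- (s :* t)) refl d e s t ⟩
    1# + d * e * - (s * t) ∎)
    where open ≡-Reasoning

  ≈-cancelˡ : ∀ {d} s {z w} → Unit d s → s * z ≈ s * w mod d → z ≈ w mod d
  ≈-cancelˡ {d} s {z} {w} (v , sv) sz≈sw = begin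
    z            ≡⟨ *-identityˡ z ⟨
    1# * z       ≈⟨ ≈-* sv ≈-refl ⟨
    s * v * z    ≡⟨ solve 3 (λ s v z → s :* v :* z := v :* (s :* z)) refl s v z ⟩
    v * (s * z)  ≈⟨ ≈-* ≈-refl sz≈sw ⟩
    v * (s * w)  ≡⟨ solve 3 (λ s v z → s :* v :* z := v :* (s :* z)) refl s v w ⟨
    s * v * w    ≈⟨ ≈-* sv ≈-refl ⟩
    1# * w       ≡⟨ *-identityˡ w ⟩
    w            ∎
    where open SetoidReasoning (≈-setoid d)

  2# 3# 4# 6# : ℤ [i]
  4# = + 4 +i + 0
  6# = + 6 +i + 0
  2# = + 2 +i + 0
  3# = + 3 +i + 0

  module _ {n : ℤ [i]} where

    Unit-cube : ∀ {z} → Unit n z → Unit (n * n * n) z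
    Unit-cube u = Unit-mod-* (Unit-mod-* u u) u

    -- In z² - w² = (z + w)(z - w) the first factor is congruent to 2w modulo n, hence a unit modulo
    -- n and therefore modulo n³. The congruence modulo n rules out the root -w.
    ≈-sqrt : ∀ {z w} → Unit n 2# → Unit n w → z ≈ w mod n →
             z * z ≈ w * w mod n * n * n → z ≈ w mod n * n * n
    ≈-sqrt {z} {w} u2 uw z≈w (by q eq) = ≈-cancelˡ (z + w)
      (Unit-cube (Unit-resp (≈-trans (≈-+ z≈w ≈-refl) (≈-reflexive
        (solve 1 (λ w → w :+ w := con 2# :* w) refl w))) (Unit-* u2 uw)))
      (by q (begin
        (z + w) * z                        ≡⟨ solve 2 (λ z w → (z :+ w) :* z := z :* z :+ w :* z) refl z w ⟩
        z * z + w * z                      ≡⟨ cong (_+ w * z) eq ⟩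
        w * w + n * n * n * q + w * z      ≡⟨ solve 3 (λ z w r → w :* w :+ r :+ w :* z :=
                                                (z :+ w) :* w :+ r) refl z w (n * n * n * q) ⟩
        (z + w) * w + n * n * n * q ∎))
      where open ≡-Reasoning

    -- In z³ - w³ = (z² + zw + w²)(z - w) the first factor is congruent to 3w² modulo n, hence a
    -- unit modulo n³.
    ≈-cbrt : ∀ {z w} → Unit n 3# → Unit n w → z ≈ w mod n →
             z * z * z ≈ w * w * w mod n * n * n → z ≈ w mod n * n * n
    ≈-cbrt {z} {w} u3 uw z≈w (by q eq) = ≈-cancelˡ s
      (Unit-cube (Unit-resp (≈-trans
         (≈-+ (≈-+ (≈-* z≈w z≈w) (≈-* z≈w ≈-refl)) ≈-refl) (≈-reflexive
        (solve 1 (λ w → w :* w :+ w :* w :+ w :* w := con 3# :* (w :* w)) refl w)))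
        (Unit-* u3 (Unit-* uw uw))))
      (by q (begin
        s * z                      ≡⟨ solve 2 (λ z w → (z :* z :+ z :* w :+ w :* w) :* z :=
                                        z :* z :* z :+ (z :* z :* w :+ z :* w :* w)) refl z w ⟩
        z * z * z + t              ≡⟨ cong (_+ t) eq ⟩
        w * w * w + n * n * n * q + t
                                   ≡⟨ solve 3 (λ z w r → w :* w :* w :+ r :+ (z :* z :* w :+ z :* w :* w) :=
                                        (z :* z :+ z :* w :+ w :* w) :* w :+ r) refl z w (n * n * n * q) ⟩
        s * w + n * n * n * q ∎))
      where
      open ≡-Reasoning
      s = z * z + z * w + w * w
      t = z * z * w + z * w * w

  -- Products with some factors left out.

  -- Unwanted factors are replaced by 1 instead of being removed from the index set, so every
  -- product still ranges over a full interval or rectangle and can be reindexed freely.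
  omit keep : {P : Set} → Dec P → ℤ [i] → ℤ [i]
  omit P? z = if does P? then 1# else z
  keep P? z = if does P? then z else 1#

  omit-yes : ∀ {P} (P? : Dec P) {z} → P → omit P? z ≡ 1#
  omit-yes (yes _) _ = refl
  omit-yes (no ¬p) p = contradiction p ¬p

  omit-cong : ∀ {P Q z w} (P? : Dec P) (Q? : Dec Q) → (P → Q) → (Q → P) →
              (¬ P → z ≡ w) → omit P? z ≡ omit Q? w
  omit-cong (yes _) (yes _) _ _ _  = refl
  omit-cong (yes p) (no ¬q) f _ _  = contradiction (f p) ¬q
  omit-cong (no ¬p) (yes q) _ g _  = contradiction (g q) ¬p
  omit-cong (no ¬p) (no _)  _ _ eq = eq ¬p

  omit-* : ∀ {P} (P? : Dec P) z w → omit P? z * omit P? w ≡ omit P? (z * w)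
  omit-* (yes _) z w = *-identityˡ 1#
  omit-* (no _)  z w = refl

  omit-≈ : ∀ {P d z w} (P? : Dec P) → (¬ P → z ≈ w mod d) → omit P? z ≈ omit P? w mod d
  omit-≈ (yes _) _ = ≈-refl
  omit-≈ (no ¬p) e = e ¬p

  Unit-omit : ∀ {P d z} (P? : Dec P) → (¬ P → Unit d z) → Unit d (omit P? z)
  Unit-omit (yes _) _ = Unit-1
  Unit-omit (no ¬p) u = u ¬p

  -- Gaussian integers with natural coordinates.

  gauss : ℕ → ℕ → ℤ [i]
  gauss x y = + x +i + y

  ⌜_⌝ : ℕ → ℤ [i]
  ⌜ n ⌝ = gauss n 0

  i : ℤ [i]
  i = gauss 0 1

  opaque
    unfolding _+_ _*_

    gauss-split : ∀ x y → gauss x y ≡ ⌜ x ⌝ + i * ⌜ y ⌝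
    gauss-split x y = cong₂ _+i_ (sym (ℤ.+-identityʳ (+ x)))
      (sym (trans (ℤ.+-identityˡ _) (trans (ℤ.+-identityˡ _) (ℤ.*-identityˡ (+ y)))))

    ⌜⌝-+ : ∀ m n → ⌜ m ℕ.+ n ⌝ ≡ ⌜ m ⌝ + ⌜ n ⌝
    ⌜⌝-+ m n = refl

    ⌜⌝-* : ∀ m n → ⌜ m ℕ.* n ⌝ ≡ ⌜ m ⌝ * ⌜ n ⌝
    ⌜⌝-* m n = cong₂ _+i_ (trans (ℤ.pos-* m n) (sym (ℤ.+-identityʳ _))) 
      (sym (trans (ℤ.+-identityʳ _) (ℤ.*-zeroʳ (+ m))))

  gauss-+ : ∀ a b c d → gauss (a ℕ.+ b) (c ℕ.+ d) ≡ gauss a c + gauss b d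
  gauss-+ a b c d rewrite gauss-split (a ℕ.+ b) (c ℕ.+ d) | gauss-split a c | gauss-split b d | ⌜⌝-+ a b | ⌜⌝-+ c d =
    solve 4 (λ a b c d → a :+ b :+ con i :* (c :+ d) := (a :+ con i :* c) :+ (b :+ con i :* d)) refl ⌜ a ⌝ ⌜ b ⌝ ⌜ c ⌝ ⌜ d ⌝

  ⌜⌝-minus : ∀ {m n k} → m ℕ.+ n ≡ k → ⌜ m ⌝ ≡ ⌜ k ⌝ - ⌜ n ⌝
  ⌜⌝-minus {m} {n} refl = trans (solve 2 (λ m n → m := m :+ n :- n) refl ⌜ m ⌝ ⌜ n ⌝)
                                (cong (_- ⌜ n ⌝) (sym (⌜⌝-+ m n)))

  ∣-complement : ∀ {p m n k} → m ℕ.+ n ≡ k → p ∣ k → p ∣ m → p ∣ n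
  ∣-complement refl p∣k p∣m = ℕ.∣m+n∣m⇒∣n p∣k p∣m

  -- With ε = N²v the two sides differ by ε(b - c).
  cross-ratio : ∀ {N b c} v → b ≈ c mod N →
                (N * N * v + c) * (0# + b) ≈ (N * N * v + b) * (0# + c) mod N * N * N
  cross-ratio {N} {c = c} v (by q refl) = by (v * q)
    (solve 4 (λ N v c q → (N :* N :* v :+ c) :* (con 0# :+ (c :+ N :* q)) :=
      (N :* N :* v :+ (c :+ N :* q)) :* (con 0# :+ c) :+ N :* N :* N :* (v :* q)) refl N v c q)

  -- Edges of a square: reflection and doubling.

  module Edge (p n′ h : ℕ) (n≡ : n′ ≡ h ℕ.+ h) (p∣n : p ∣ suc n′)
    (p-odd : ∀ j → p ∣ j ℕ.+ j → p ∣ j)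
    (unit : ∀ j → ¬ p ∣ j → Unit ⌜ suc n′ ⌝ ⌜ j ⌝)
    (unit-2 : Unit ⌜ suc n′ ⌝ 2#) (unit-3 : Unit ⌜ suc n′ ⌝ 3#)
    (θ : ℤ [i]) (unit-θ : Unit ⌜ suc n′ ⌝ θ) where

    private
      n = suc n′
      N = ⌜ n ⌝

    -- The direction θ is 1 for a horizontal edge and i for a vertical one; the distance n of the
    -- edge from the axis is absorbed into w.
    edge : ℤ [i] → ℤ [i]
    edge w = ∏ n′ λ j → omit (p ∣? suc j) (N * w + θ * ⌜ suc j ⌝)

    -- The product of the mirror factors θj and θ(n - j), which is what a pair contributes at
    -- `w = 0#`.
    a : ℕ → ℤ [i]
    a j = θ * θ * (⌜ j ⌝ * (N - ⌜ j ⌝))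

    module _ (w : ℤ [i]) where

      private
        v = w * w + θ * w
        ε = N * N * v

      -- Each factor is paired with its mirror image: (nw + θj)(nw + θ(n - j)) = n²(w² + θw) + θ²j(n
      -- - j). The dependence on w is now confined to ε, a multiple of n².
      edge² : edge w * edge w ≡ ∏ n′ λ j → omit (p ∣? suc j) (ε + a (suc j))
      edge² = begin
        edge w * edge w
          ≡⟨ cong (edge w *_) (∏-reflect n′ _ _ λ j k e →
               let s = trans (cong suc (ℕ.+-suc j k)) (cong suc e) in
               omit-cong (p ∣? suc j) (p ∣? suc k) (∣-complement s p∣n)
                 (∣-complement (trans (ℕ.+-comm (suc k) (suc j)) s) p∣n)
                 (λ _ → cong (λ x → N * w + θ * x) (⌜⌝-minus s))) ⟩
        edge w * ∏ n′ (λ j → omit (p ∣? suc j) (N * w + θ * (N - ⌜ suc j ⌝)))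
          ≡⟨ ∏-* n′ _ _ ⟨
        _ ≡⟨ ∏-cong n′ (λ j _ → trans (omit-* (p ∣? suc j) _ _) (cong (omit (p ∣? suc j))
               (solve 4 (λ N w θ j → (N :* w :+ θ :* j) :* (N :* w :+ θ :* (N :- j)) :=
                 N :* N :* (w :* w :+ θ :* w) :+ θ :* θ :* (j :* (N :- j))) refl N w θ ⌜ suc j ⌝))) ⟩
        _ ∎
        where open ≡-Reasoning

    private
      -- `F` is periodic modulo n, so doubling the index permutes its factors over a period. `G`
      -- carries 4a(j), the value of a(2j) modulo n.
      F G : ℤ [i] → ℕ → ℤ [i]
      F x j = omit (p ∣? j) (x + a (j ℕ.% n))
      G x j = omit (p ∣? j) (x + 4# * a (j ℕ.% n))

      p∣-% : ∀ j → p ∣ j ℕ.% n → p ∣ j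
      p∣-% j p∣r = subst (p ∣_) (sym (ℕ.m≡m%n+[m/n]*n j n))
        (ℕ.∣m∣n⇒∣m+n p∣r (ℕ.∣n⇒∣m*n (j ℕ./ n) p∣n))

      ⌜%⌝ : ∀ j → ⌜ j ⌝ ≈ ⌜ j ℕ.% n ⌝ mod N
      ⌜%⌝ j = by ⌜ j ℕ./ n ⌝ (begin
        ⌜ j ⌝                                 ≡⟨ cong ⌜_⌝ (ℕ.m≡m%n+[m/n]*n j n) ⟩
        ⌜ j ℕ.% n ℕ.+ j ℕ./ n ℕ.* n ⌝         ≡⟨ ⌜⌝-+ (j ℕ.% n) _ ⟩
        ⌜ j ℕ.% n ⌝ + ⌜ j ℕ./ n ℕ.* n ⌝       ≡⟨ cong (λ x → ⌜ j ℕ.% n ⌝ + x) (⌜⌝-* (j ℕ./ n) n) ⟩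
        ⌜ j ℕ.% n ⌝ + ⌜ j ℕ./ n ⌝ * N         ≡⟨ cong (λ x → ⌜ j ℕ.% n ⌝ + x) (*-comm _ N) ⟩
        ⌜ j ℕ.% n ⌝ + N * ⌜ j ℕ./ n ⌝         ∎)
        where open ≡-Reasoning

      a-≈ : ∀ j → a j ≈ - (θ * θ * (⌜ j ⌝ * ⌜ j ⌝)) mod N
      a-≈ j = by (θ * θ * ⌜ j ⌝) (solve 3 (λ θ j N → θ :* θ :* (j :* (N :- j)) :=
        :- (θ :* θ :* (j :* j)) :+ N :* (θ :* θ :* j)) refl θ ⌜ j ⌝ N)

      -- Modulo n, a(j) ≡ -θ²j² depends only on the residue of j and is multiplied by 4 when j is
      -- doubled.
      a-double : ∀ j → a ((j ℕ.+ j) ℕ.% n) ≈ 4# * a (j ℕ.% n) mod N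
      a-double j = begin
        a ((j ℕ.+ j) ℕ.% n)        ≈⟨ a-≈ _ ⟩
        - (θ * θ * (s * s))        ≈⟨ ≈-neg (≈-* ≈-refl (≈-* s≈ s≈)) ⟩
        - (θ * θ * ((r + r) * (r + r)))
                                   ≡⟨ solve 2 (λ θ r → :- (θ :* θ :* ((r :+ r) :* (r :+ r))) :=
                                        con 4# :* :- (θ :* θ :* (r :* r))) refl θ r ⟩
        4# * - (θ * θ * (r * r))   ≈⟨ ≈-* ≈-refl (a-≈ _) ⟨
        4# * a (j ℕ.% n)           ∎
        where
        open SetoidReasoning (≈-setoid N)
        r = ⌜ j ℕ.% n ⌝
        s = ⌜ (j ℕ.+ j) ℕ.% n ⌝
        s≈ : s ≈ r + r mod N
        s≈ = ≈-trans (≈-sym (⌜%⌝ (j ℕ.+ j))) (≈-trans (≈-reflexive (⌜⌝-+ j j)) (≈-+ (⌜%⌝ j) (⌜%⌝ j)))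

      unit-4 : Unit N 4#
      unit-4 = Unit-resp (≈-reflexive (solve 0 (con 4# := con 2# :* con 2#) refl)) (Unit-* unit-2 unit-2)

      unit-a : ∀ j → ¬ p ∣ j → Unit N (a (j ℕ.% n))
      unit-a j p∤j = Unit-resp (a-≈ (j ℕ.% n)) (Unit-neg (Unit-* (Unit-* unit-θ unit-θ) (Unit-* u u)))
        where
        u = unit (j ℕ.% n) (p∤j ∘ p∣-% j)

      F-periodic : ∀ x j → F x (n ℕ.+ j) ≡ F x j
      F-periodic x j = omit-cong (p ∣? (n ℕ.+ j)) (p ∣? j)
        (λ d → ℕ.∣m+n∣m⇒∣n d p∣n) (ℕ.∣m∣n⇒∣m+n p∣n)
        (λ _ → cong (λ r → x + a r) (trans (cong (ℕ._% n) (ℕ.+-comm n j)) (ℕ.[m+n]%n≡m%n j n)))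

      ∏F : ∀ x → ∏ n′ (λ j → omit (p ∣? suc j) (x + a (suc j))) ≡ ∏ n (F x)
      ∏F x = begin
        _ ≡⟨ ∏-cong n′ (λ j j< → cong (λ r → omit (p ∣? suc j) (x + a r)) (sym (ℕ.m<n⇒m%n≡m (ℕ.s≤s j<)))) ⟩
        ∏ n′ (F x ∘ suc)         ≡⟨ *-identityˡ _ ⟨
        -- Index 0 contributes 1, since p divides 0; including it completes 1, ..., n - 1 to a full
        -- set of residues modulo n.
        1# * ∏ n′ (F x ∘ suc)    ≡⟨ cong (_* ∏ n′ (F x ∘ suc)) (omit-yes (p ∣? 0) (p ℕ.∣0)) ⟨
        F x 0 * ∏ n′ (F x ∘ suc) ≡⟨ ∏-head n′ (F x) ⟨
        ∏ n (F x) ∎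
        where open ≡-Reasoning

      ∏F-double : ∀ x → ∏ n (λ j → F x (j ℕ.+ j)) ≡ ∏ n (F x)
      ∏F-double x = subst (λ m → ∏ m (λ j → F x (j ℕ.+ j)) ≡ ∏ m (F x)) (cong suc (sym n≡))
        (∏-double h (F x) λ j → trans (cong (λ m → F x (suc m ℕ.+ j)) (sym n≡)) (F-periodic x j))

      module _ (v : ℤ [i]) where

        N³ = N * N * N
        ε = N * N * v

        ε≈0 : ε ≈ 0# mod N
        ε≈0 = by (N * v) (solve 2 (λ N v → N :* N :* v := con 0# :+ N :* (N :* v)) refl N v)

        unit-ΠG : ∀ {x} → x ≈ 0# mod N → Unit N (∏ n (G x))
        unit-ΠG x≈0 = Unit-∏ n λ j _ → Unit-omit (p ∣? j) λ p∤j →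
          Unit-resp (≈-trans (≈-+ x≈0 ≈-refl) (≈-reflexive (+-identityˡ _))) (Unit-* unit-4 (unit-a j p∤j))

        unit-F0 : Unit N (∏ n (F 0#))
        unit-F0 = Unit-∏ n λ j _ → Unit-omit (p ∣? j) λ p∤j →
          Unit-resp (≈-reflexive (+-identityˡ _)) (unit-a j p∤j)

        F-double : ∀ x j → F x (j ℕ.+ j) ≡ omit (p ∣? j) (x + a ((j ℕ.+ j) ℕ.% n))
        F-double x j = omit-cong (p ∣? (j ℕ.+ j)) (p ∣? j) (p-odd j) (λ d → ℕ.∣m∣n⇒∣m+n d d) λ _ → refl

        -- Cross-multiplied form of (ε + c)/c ≡ (ε + b)/b: in these ratios a(2j) may be exchanged
        -- for 4a(j) modulo n³, although the two agree only modulo n.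
        cross : ∀ j → G ε j * F 0# (j ℕ.+ j) ≈ F ε (j ℕ.+ j) * G 0# j mod N³
        cross j = begin
          G ε j * F 0# (j ℕ.+ j)
            ≡⟨ cong (G ε j *_) (F-double 0# j) ⟩
          omit (p ∣? j) (ε + c) * omit (p ∣? j) (0# + b)
            ≡⟨ omit-* (p ∣? j) _ _ ⟩
          omit (p ∣? j) ((ε + c) * (0# + b))
            ≈⟨ omit-≈ (p ∣? j) (λ _ → cross-ratio v (a-double j)) ⟩
          omit (p ∣? j) ((ε + b) * (0# + c))
            ≡⟨ omit-* (p ∣? j) _ _ ⟨
          omit (p ∣? j) (ε + b) * omit (p ∣? j) (0# + c)
            ≡⟨ cong (_* G 0# j) (F-double ε j) ⟨
          F ε (j ℕ.+ j) * G 0# j ∎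
          where
          open SetoidReasoning (≈-setoid N³)
          b = a ((j ℕ.+ j) ℕ.% n)
          c = 4# * a (j ℕ.% n)

        fours = ∏ n λ j → omit (p ∣? j) 4#

        unit-fours : Unit N³ fours
        unit-fours = Unit-cube (Unit-∏ n λ j _ → Unit-omit (p ∣? j) λ _ → unit-4)

        ∏F-scaled : ∀ x → fours * ∏ n (F x) ≡ ∏ n λ j → omit (p ∣? j) (4# * (x + a (j ℕ.% n)))
        ∏F-scaled x = trans (sym (∏-* n _ _)) (∏-cong n λ j _ → omit-* (p ∣? j) _ _)

        ∏F0-scaled : fours * ∏ n (F 0#) ≡ ∏ n (G 0#)
        ∏F0-scaled = trans (∏F-scaled 0#) (∏-cong n λ j _ → cong (omit (p ∣? j))
          (solve 1 (λ a → con 4# :* (con 0# :+ a) := con 0# :+ con 4# :* a) refl (a (j ℕ.% n))))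

        -- Put P = ∏ (1 + ε/4a) and Q = ∏ (1 + ε/a), over the j prime to p. Multiplying `cross` over
        -- all j, with doubling as a permutation, gives P ≡ Q modulo n³; the factor `fours` turns ∏
        -- a into ∏ 4a.
        ∏G≈ : ∏ n (G ε) ≈ fours * ∏ n (F ε) mod N³
        ∏G≈ = ≈-cancelˡ (∏ n (F 0#)) (Unit-cube unit-F0) (begin
          ∏ n (F 0#) * ∏ n (G ε)
            ≡⟨ trans (*-comm _ _) (cong (∏ n (G ε) *_) (sym (∏F-double 0#))) ⟩
          ∏ n (G ε) * ∏ n (λ j → F 0# (j ℕ.+ j))
            ≡⟨ ∏-* n _ _ ⟨
          ∏ n (λ j → G ε j * F 0# (j ℕ.+ j))
            ≈⟨ ∏-≈ n (λ j _ → cross j) ⟩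
          ∏ n (λ j → F ε (j ℕ.+ j) * G 0# j)
            ≡⟨ ∏-* n _ _ ⟩
          ∏ n (λ j → F ε (j ℕ.+ j)) * ∏ n (G 0#)
            ≡⟨ cong₂ _*_ (∏F-double ε) (sym ∏F0-scaled) ⟩
          ∏ n (F ε) * (fours * ∏ n (F 0#))
            ≡⟨ solve 3 (λ a b c → a :* (b :* c) := c :* (b :* a)) refl (∏ n (F ε)) fours (∏ n (F 0#)) ⟩
          ∏ n (F 0#) * (fours * ∏ n (F ε)) ∎)
          where open SetoidReasoning (≈-setoid N³)

        -- (ε + b)⁴ ≡ b³(4ε + b), as n³ divides ε².
        fourth : ∀ j → G ε j * G ε j * G ε j * G ε j ≈
                       G 0# j * G 0# j * G 0# j * omit (p ∣? j) (4# * (ε + a (j ℕ.% n))) mod N³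
        fourth j with p ∣? j
        ... | yes _ = ≈-refl
        ... | no _  = by (N * v * v * (6# * (b * b) + 4# * (ε * b) + ε * ε))
          (solve 3 (λ N v a → let ε = N :* N :* v ; b = con 4# :* a ; o = con 0# in
            (ε :+ b) :* (ε :+ b) :* (ε :+ b) :* (ε :+ b) :=
            (o :+ b) :* (o :+ b) :* (o :+ b) :* (con 4# :* (ε :+ a)) :+
            N :* N :* N :* (N :* v :* v :* (con 6# :* (b :* b) :+ con 4# :* (ε :* b) :+ ε :* ε)))
            refl N v (a (j ℕ.% n)))
          where b = 4# * a (j ℕ.% n)

        -- The fourth powers give P⁴ ≡ Q, and Q ≡ P by `∏G≈`; cancelling the unit P leaves P³ ≡ 1.
        cubes : ∏ n (G ε) * ∏ n (G ε) * ∏ n (G ε) ≈ ∏ n (G 0#) * ∏ n (G 0#) * ∏ n (G 0#) mod N³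
        cubes = ≈-cancelˡ (∏ n (G ε)) (Unit-cube (unit-ΠG ε≈0)) (begin
          Gε * (Gε * Gε * Gε)
            ≡⟨ *-comm Gε _ ⟩
          Gε * Gε * Gε * Gε
            ≡⟨ power4 (G ε) (G ε) ⟨
          ∏ n (λ j → G ε j * G ε j * G ε j * G ε j)
            ≈⟨ ∏-≈ n (λ j _ → fourth j) ⟩
          ∏ n (λ j → G 0# j * G 0# j * G 0# j * omit (p ∣? j) (4# * (ε + a (j ℕ.% n))))
            ≡⟨ power4 (G 0#) _ ⟩
          G0 * G0 * G0 * ∏ n (λ j → omit (p ∣? j) (4# * (ε + a (j ℕ.% n))))
            ≡⟨ cong (G0 * G0 * G0 *_) (∏F-scaled ε) ⟨
          G0 * G0 * G0 * (fours * ∏ n (F ε))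
            ≈⟨ ≈-* ≈-refl ∏G≈ ⟨
          G0 * G0 * G0 * Gε
            ≡⟨ *-comm _ Gε ⟩
          Gε * (G0 * G0 * G0) ∎)
          where
          open SetoidReasoning (≈-setoid N³)
          Gε = ∏ n (G ε)
          G0 = ∏ n (G 0#)
          power4 : ∀ f g → ∏ n (λ j → f j * f j * f j * g j) ≡ ∏ n f * ∏ n f * ∏ n f * ∏ n g
          power4 f g = trans (∏-* n _ g) (cong (_* ∏ n g)
            (trans (∏-* n _ f) (cong (_* ∏ n f) (∏-* n f f))))

        -- As n divides ε, P ≡ 1 modulo n, so P³ ≡ 1 has only the root P ≡ 1 modulo n³; then Q ≡ P ≡
        -- 1 as well.
        ∏F-≈ : ∏ n (F ε) ≈ ∏ n (F 0#) mod N³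
        ∏F-≈ = ≈-cancelˡ fours unit-fours (begin
          fours * ∏ n (F ε)  ≈⟨ ∏G≈ ⟨
          ∏ n (G ε)          ≈⟨ ≈-cbrt unit-3 (unit-ΠG ≈-refl)
                                  (∏-≈ n λ j _ → omit-≈ (p ∣? j) λ _ → ≈-+ ε≈0 ≈-refl) cubes ⟩
          ∏ n (G 0#)         ≡⟨ ∏F0-scaled ⟨
          fours * ∏ n (F 0#) ∎)
          where open SetoidReasoning (≈-setoid N³)

    edge-constant : ∀ w → edge w ≈ edge 0# mod N * N * N
    edge-constant w = ≈-sqrt unit-2 unit-0 (∏-≈ n′ λ j _ → omit-≈ (p ∣? suc j) λ _ → ≈-+ Nw≈0 ≈-refl) (begin
      edge w * edge w      ≡⟨ trans (edge² w) (∏F _) ⟩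
      ∏ n (F (N * N * (w * w + θ * w)))
                           ≈⟨ ∏F-≈ (w * w + θ * w) ⟩
      -- At w = 0 the quantity ε vanishes, so this is the paired form of `edge 0#`.
      ∏ n (F 0#)           ≡⟨ cong (λ x → ∏ n (F x)) (solve 2 (λ N θ →
                                con 0# := N :* N :* (con 0# :* con 0# :+ θ :* con 0#)) refl N θ) ⟩
      ∏ n (F (N * N * (0# * 0# + θ * 0#)))
                           ≡⟨ trans (edge² 0#) (∏F _) ⟨
      edge 0# * edge 0#    ∎)
      where
      open SetoidReasoning (≈-setoid (N * N * N))

      Nw≈0 : N * w ≈ N * 0# mod N
      Nw≈0 = by w (solve 2 (λ N w → N :* w := N :* con 0# :+ N :* w) refl N w)

      unit-0 : Unit N (edge 0#)
      unit-0 = Unit-∏ n′ λ j _ → Unit-omit (p ∣? suc j) λ p∤ → Unit-resp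
        (≈-reflexive (solve 2 (λ N x → N :* con 0# :+ x := x) refl N (θ * ⌜ suc j ⌝)))
        (Unit-* unit-θ (unit (suc j) p∤))

  -- Squares: the quarter turn and the decomposition into interior and edges.

  -- The quarter turn (x, y) ↦ (n + 1 - y, x) permutes the grid {1, ..., n}². On the interior of a
  -- square of side n it is applied with n - 1, where it becomes u ↦ n + iu.
  ∏-rotate : ∀ n (f : ℕ → ℕ → ℤ [i]) →
             ∏ n (λ j → ∏ n λ k → f (suc j) (suc k)) ≡ ∏ n (λ j → ∏ n λ k → f (n ℕ.∸ k) (suc j))
  ∏-rotate n f = trans
    (∏-reflect n _ _ λ j k e → ∏-cong n λ l _ → cong (λ m → f m (suc l)) (lemma j k e))
    (∏-comm n n λ k j → f (n ℕ.∸ k) (suc j))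
    where
    lemma : ∀ j k → suc (j ℕ.+ k) ≡ n → suc j ≡ n ℕ.∸ k
    lemma j k refl = sym (ℕ.m+n∸n≡m (suc j) k)

  ∣∸⇒∣ : ∀ {p m n} → m ≤ n → p ∣ n → p ∣ n ℕ.∸ m → p ∣ m
  ∣∸⇒∣ m≤n = ∣-complement (ℕ.m∸n+n≡m m≤n)

  ∣⇒∣∸ : ∀ {p m n} → m ≤ n → p ∣ n → p ∣ m → p ∣ n ℕ.∸ m
  ∣⇒∣∸ m≤n = ∣-complement (ℕ.m+[n∸m]≡n m≤n)

  coprimeFactor : ℕ → ℤ [i] → ℕ → ℕ → ℤ [i]
  coprimeFactor p z x y = omit (p ∣? x ×-dec p ∣? y) (z + gauss x y)

  module Square (p n′ h : ℕ) (n≡ : n′ ≡ h ℕ.+ h) (p∣n : p ∣ suc n′)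
    (p-odd : ∀ j → p ∣ j ℕ.+ j → p ∣ j)
    (unit : ∀ x y → ¬ (p ∣ x × p ∣ y) → Unit ⌜ suc n′ ⌝ (gauss x y))
    (unit-2 : Unit ⌜ suc n′ ⌝ 2#) (unit-3 : Unit ⌜ suc n′ ⌝ 3#) where

    private
      n = suc n′
      N = ⌜ n ⌝
      N³ = N * N * N

      p∣? : ∀ x y → Dec (p ∣ x × p ∣ y)
      p∣? x y = p ∣? x ×-dec p ∣? y

      f : ℤ [i] → ℕ → ℕ → ℤ [i]
      f w = coprimeFactor p (N * w)

    square interior : ℤ [i] → ℤ [i]
    square   w = ∏ n λ j → ∏ n λ k → f w (suc j) (suc k)
    interior w = ∏ n′ λ j → ∏ n′ λ k → f w (suc j) (suc k)

    private
      -- Products of nw + u over the half-turn pair u, n + in - u, and over the full orbit, which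
      -- adds n + iu and in - iu.
      q₂ q₄ : ℤ [i] → ℕ → ℕ → ℤ [i]
      q₂ w x y = (N * w + gauss x y) * (N * w + (N + i * N - gauss x y))
      q₄ w x y = q₂ w x y * ((N * w + (N + i * gauss x y)) * (N * w + (i * N - i * gauss x y)))

      ⌜∸⌝ : ∀ {m} → m ≤ n → ⌜ n ℕ.∸ m ⌝ ≡ N - ⌜ m ⌝
      ⌜∸⌝ m≤n = ⌜⌝-minus (ℕ.m∸n+n≡m m≤n)

      half-turn : ∀ {x y} → x ≤ n → y ≤ n → gauss (n ℕ.∸ x) (n ℕ.∸ y) ≡ N + i * N - gauss x y
      half-turn {x} {y} x≤n y≤n
        rewrite gauss-split (n ℕ.∸ x) (n ℕ.∸ y) | gauss-split x y | ⌜∸⌝ x≤n | ⌜∸⌝ y≤n =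
        solve 3 (λ n x y → n :- x :+ con i :* (n :- y) := n :+ con i :* n :- (x :+ con i :* y))
          refl N ⌜ x ⌝ ⌜ y ⌝

      quarter-turn : ∀ {x y} → y ≤ n → gauss (n ℕ.∸ y) x ≡ N + i * gauss x y
      quarter-turn {x} {y} y≤n rewrite gauss-split (n ℕ.∸ y) x | gauss-split x y | ⌜∸⌝ y≤n =
        solve 3 (λ n x y → n :- y :+ con i :* x := n :+ con i :* (x :+ con i :* y)) refl N ⌜ x ⌝ ⌜ y ⌝

      interior² : ∀ w → interior w * interior w ≡
                  ∏ n′ λ j → ∏ n′ λ k → omit (p∣? (suc j) (suc k)) (q₂ w (suc j) (suc k))
      interior² w = begin
        interior w * interior w
          -- Two quarter turns make the half turn.
          ≡⟨ cong (interior w *_) (trans (∏-rotate n′ (f w)) (∏-rotate n′ λ x y → f w (n ℕ.∸ y) x)) ⟩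
        interior w * ∏ n′ (λ j → ∏ n′ λ k → f w (n′ ℕ.∸ j) (n′ ℕ.∸ k))
          ≡⟨ ∏-*₂ n′ n′ _ _ ⟨
        ∏ n′ (λ j → ∏ n′ λ k → f w (suc j) (suc k) * f w (n′ ℕ.∸ j) (n′ ℕ.∸ k))
          ≡⟨ ∏-cong₂ n′ n′ (λ j k j< k< → trans
               (cong (f w (suc j) (suc k) *_) (omit-cong (p∣? _ _) (p∣? (suc j) (suc k))
                 (λ (a , b) → ∣∸⇒∣ (≤n j<) p∣n a , ∣∸⇒∣ (≤n k<) p∣n b)
                 (λ (a , b) → ∣⇒∣∸ (≤n j<) p∣n a , ∣⇒∣∸ (≤n k<) p∣n b)
                 (λ _ → cong (λ u → N * w + u) (half-turn (≤n j<) (≤n k<)))))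
               (omit-* (p∣? (suc j) (suc k)) _ _)) ⟩
        _ ∎
        where
        open ≡-Reasoning
        ≤n : ∀ {j} → j < n′ → suc j ≤ n
        ≤n = ℕ.m<n⇒m<1+n

      interior⁴ : ∀ w → (interior w * interior w) * (interior w * interior w) ≡
                  ∏ n′ λ j → ∏ n′ λ k → omit (p∣? (suc j) (suc k)) (q₄ w (suc j) (suc k))
      interior⁴ w = begin
        (interior w * interior w) * (interior w * interior w)
          -- Only one of the two squares is turned, so each half-turn pair meets the pair that
          -- completes its orbit.
          ≡⟨ cong₂ _*_ (interior² w) (trans (interior² w) (∏-rotate n′ g)) ⟩
        ∏ n′ (λ j → ∏ n′ λ k → g (suc j) (suc k)) * ∏ n′ (λ j → ∏ n′ λ k → g (n′ ℕ.∸ k) (suc j))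
          ≡⟨ ∏-*₂ n′ n′ _ _ ⟨
        ∏ n′ (λ j → ∏ n′ λ k → g (suc j) (suc k) * g (n′ ℕ.∸ k) (suc j))
          ≡⟨ ∏-cong₂ n′ n′ (λ j k j< k< → trans
               (cong (g (suc j) (suc k) *_) (omit-cong (p∣? _ _) (p∣? (suc j) (suc k))
                 (λ (a , b) → b , ∣∸⇒∣ (ℕ.m<n⇒m<1+n k<) p∣n a)
                 (λ (a , b) → ∣⇒∣∸ (ℕ.m<n⇒m<1+n k<) p∣n b , a)
                 (λ _ → q₂-turn (ℕ.m<n⇒m<1+n k<))))
               (omit-* (p∣? (suc j) (suc k)) _ _)) ⟩
        _ ∎
        where
        open ≡-Reasoning
        g : ℕ → ℕ → ℤ [i]
        g x y = omit (p∣? x y) (q₂ w x y)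

        q₂-turn : ∀ {x y} → y ≤ n → q₂ w (n ℕ.∸ y) x ≡
          (N * w + (N + i * gauss x y)) * (N * w + (i * N - i * gauss x y))
        q₂-turn {x} {y} y≤n rewrite quarter-turn {x} {y} y≤n =
          cong (λ u → (N * w + (N + i * gauss x y)) * (N * w + u))
            (solve 2 (λ n u → n :+ con i :* n :- (n :+ con i :* u) := con i :* n :- con i :* u)
              refl N (gauss x y))

      -- The rotation has centre c = n(1 + i)/2, so the orbit product is (nw + c)⁴ - (u - c)⁴, and
      -- subtracting its value at w = 0 leaves (nw + c)⁴ - c⁴, a multiple of n⁴.
      q₄-constant : ∀ w x y → q₄ w x y ≈ q₄ 0# x y mod N³
      q₄-constant w x y = by _ (solve 3 (λ w n u →
        -- The coefficients of w³, w² and w in (w + (1 + i)/2)⁴.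
        let r = con 2# :* (con 1# :+ con i) ; s = con 3# :* con i ; t = con i :- con 1#
            q = λ w → (n :* w :+ u) :* (n :* w :+ (n :+ con i :* n :- u)) :*
                      ((n :* w :+ (n :+ con i :* u)) :* (n :* w :+ (con i :* n :- con i :* u))) in
        q w := q (con 0#) :+ n :* n :* n :* (n :* (w :* w :* w :* w :+ r :* w :* w :* w :+ s :* w :* w :+ t :* w)))
        refl w N (gauss x y))

      Nw≈0 : ∀ {w u} → N * w + u ≈ N * 0# + u mod N
      Nw≈0 {w} {u} = by w (solve 3 (λ n w u → n :* w :+ u := n :* con 0# :+ u :+ n :* w) refl N w u)

      unit-f : ∀ x y → Unit N (f 0# x y)
      unit-f x y = Unit-omit (p∣? x y) λ p∤ → Unit-resp
        (≈-reflexive (solve 2 (λ n u → n :* con 0# :+ u := u) refl N (gauss x y))) (unit x y p∤)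

      interior-constant : ∀ w → interior w ≈ interior 0# mod N³
      interior-constant w =
        -- The inner root passes from fourth powers to squares, the outer one from squares to the
        -- products themselves.
        ≈-sqrt unit-2 unit-interior w≈0 (≈-sqrt unit-2 (Unit-* unit-interior unit-interior) (≈-* w≈0 w≈0)
          (begin
            _ ≡⟨ interior⁴ w ⟩
            _ ≈⟨ ∏-≈ n′ (λ j _ → ∏-≈ n′ λ k _ →
                   omit-≈ (p∣? (suc j) (suc k)) λ _ → q₄-constant w (suc j) (suc k)) ⟩
            _ ≡⟨ interior⁴ 0# ⟨
            _ ∎))
        where
        open SetoidReasoning (≈-setoid N³)
        unit-interior : Unit N (interior 0#)
        unit-interior = Unit-∏ n′ λ j _ → Unit-∏ n′ λ k _ → unit-f (suc j) (suc k)

        w≈0 : interior w ≈ interior 0# mod N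
        w≈0 = ∏-≈ n′ λ j _ → ∏-≈ n′ λ k _ → omit-≈ (p∣? (suc j) (suc k)) λ _ → Nw≈0

      unit-ℕ : ∀ j → ¬ p ∣ j → Unit N ⌜ j ⌝
      unit-ℕ j p∤j = unit j 0 (p∤j ∘ proj₁)

      unit-i : Unit N i
      unit-i = - i , ≈-reflexive (solve 0 (con i :* :- con i := con 1#) refl)

      module E₁ = Edge p n′ h n≡ p∣n p-odd unit-ℕ unit-2 unit-3 1# Unit-1
      module Eᵢ = Edge p n′ h n≡ p∣n p-odd unit-ℕ unit-2 unit-3 i unit-i

      top : ∀ w → ∏ n′ (λ j → f w (suc j) n) ≡ E₁.edge (w + i)
      top w = ∏-cong n′ λ j _ → omit-cong (p∣? (suc j) n) (p ∣? suc j) proj₁ (λ d → d , p∣n)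
        λ _ → trans (cong (λ u → N * w + u) (gauss-split (suc j) n))
          (solve 3 (λ n w x → n :* w :+ (x :+ con i :* n) := n :* (w :+ con i) :+ con 1# :* x)
            refl N w ⌜ suc j ⌝)

      right : ∀ w → ∏ n′ (λ k → f w n (suc k)) ≡ Eᵢ.edge (w + 1#)
      right w = ∏-cong n′ λ k _ → omit-cong (p∣? n (suc k)) (p ∣? suc k) proj₂ (λ d → p∣n , d)
        λ _ → trans (cong (λ u → N * w + u) (gauss-split n (suc k)))
          (solve 3 (λ n w x → n :* w :+ (n :+ con i :* x) := n :* (w :+ con 1#) :+ con i :* x)
            refl N w ⌜ suc k ⌝)

      square-parts : ∀ w → square w ≡ interior w * E₁.edge (w + i) * (Eᵢ.edge (w + 1#) * 1#)
      square-parts w = cong₂ _*_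
        (trans (∏-* n′ _ _) (cong (interior w *_) (top w)))
        -- The corner (n, n) contributes 1, because p divides n.
        (cong₂ _*_ (right w) (omit-yes (p∣? n n) (p∣n , p∣n)))

    square-constant : ∀ w → square w ≈ square 0# mod N³
    square-constant w = begin
      square w                                               ≡⟨ square-parts w ⟩
      interior w * E₁.edge (w + i) * (Eᵢ.edge (w + 1#) * 1#)
        ≈⟨ ≈-* (≈-* (interior-constant w) (shift E₁.edge E₁.edge-constant i))
               (≈-* (shift Eᵢ.edge Eᵢ.edge-constant 1#) ≈-refl) ⟩
      interior 0# * E₁.edge (0# + i) * (Eᵢ.edge (0# + 1#) * 1#) ≡⟨ square-parts 0# ⟨
      square 0# ∎
      where
      open SetoidReasoning (≈-setoid N³)
      shift : ∀ (e : ℤ [i] → ℤ [i]) → (∀ w → e w ≈ e 0# mod N³) → ∀ s → e (w + s) ≈ e (0# + s) mod N³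
      shift e const s = ≈-trans (const (w + s)) (≈-sym (const (0# + s)))

  -- Sums of two squares and primes congruent to 3 modulo 4.

  halve : ∀ n → Σ[ t ∈ ℕ ] (n ≡ t ℕ.+ t ⊎ n ≡ suc (t ℕ.+ t))
  halve zero = 0 , inj₁ refl
  halve (suc n) with halve n
  ... | t , inj₁ refl = t , inj₂ refl
  ... | t , inj₂ refl = suc t , inj₁ (cong suc (sym (ℕ.+-suc t t)))

  Odd : ℕ → Set
  Odd n = Σ[ h ∈ ℕ ] n ≡ suc (h ℕ.+ h)

  odd-* : ∀ {m n} → Odd m → Odd n → Odd (m ℕ.* n)
  odd-* (a , refl) (b , refl) = a ℕ.+ b ℕ.+ 2 ℕ.* a ℕ.* b , identity a b
    where
    identity : ∀ a b → suc (a ℕ.+ a) ℕ.* suc (b ℕ.+ b) ≡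
               suc ((a ℕ.+ b ℕ.+ 2 ℕ.* a ℕ.* b) ℕ.+ (a ℕ.+ b ℕ.+ 2 ℕ.* a ℕ.* b))
    identity = solve-∀

  odd-^ : ∀ {m} → Odd m → ∀ k → Odd (m ℕ.^ k)
  odd-^ odd zero    = 0 , refl
  odd-^ odd (suc k) = odd-* odd (odd-^ odd k)

  %4≡3⇒odd : ∀ q → q ℕ.% 4 ≡ 3 → Odd q
  %4≡3⇒odd q q%4≡3 = suc (q ℕ./ 4 ℕ.+ q ℕ./ 4) , trans (ℕ.m≡m%n+[m/n]*n q 4)
    (trans (cong (ℕ._+ q ℕ./ 4 ℕ.* 4) q%4≡3) (identity (q ℕ./ 4)))
    where
    identity : ∀ k → 3 ℕ.+ k ℕ.* 4 ≡ suc (suc (k ℕ.+ k) ℕ.+ suc (k ℕ.+ k))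
    identity = solve-∀

  -- Let r be the residue of x. If r is odd, then q - r is even since q is odd, and its square has
  -- the same residue. Evenness is needed by the descent: it makes the square plus one congruent to
  -- 1 modulo 4.
  even-root : ∀ q x .{{_ : ℕ.NonZero q}} → Odd q → q ∣ suc (x ℕ.* x) →
              Σ[ t ∈ ℕ ] (t ℕ.+ t < q × q ∣ suc ((t ℕ.+ t) ℕ.* (t ℕ.+ t)))
  even-root q x (c , q≡) q∣x²+1 = go (halve r) (ℕ.m%n<n x q) q∣r²+1
    where
    r = x ℕ.% q
    l = x ℕ./ q

    identity₁ : ∀ q r l → suc ((r ℕ.+ l ℕ.* q) ℕ.* (r ℕ.+ l ℕ.* q)) ≡
                (2 ℕ.* r ℕ.* l ℕ.+ l ℕ.* l ℕ.* q) ℕ.* q ℕ.+ suc (r ℕ.* r)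
    identity₁ = solve-∀

    identity₂ : ∀ r s → (2 ℕ.* r) ℕ.* (r ℕ.+ (s ℕ.+ s)) ℕ.+ suc ((s ℕ.+ s) ℕ.* (s ℕ.+ s)) ≡
                suc (r ℕ.* r) ℕ.+ (r ℕ.+ (s ℕ.+ s)) ℕ.* (r ℕ.+ (s ℕ.+ s))
    identity₂ = solve-∀

    identity₃ : ∀ t s → suc (t ℕ.+ t) ℕ.+ (s ℕ.+ s) ≡ suc ((t ℕ.+ s) ℕ.+ (t ℕ.+ s))
    identity₃ = solve-∀

    -- Subtraction-free form of (q - r)² ≡ r² modulo q, with q = r + 2s.
    reflected : ∀ r s → r ℕ.+ (s ℕ.+ s) ∣ suc (r ℕ.* r) → r ℕ.+ (s ℕ.+ s) ∣ suc ((s ℕ.+ s) ℕ.* (s ℕ.+ s))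
    reflected r s q∣ = ℕ.∣m+n∣m⇒∣n
      (subst (r ℕ.+ (s ℕ.+ s) ∣_) (sym (identity₂ r s)) (ℕ.∣m∣n⇒∣m+n q∣ (ℕ.m∣m*n (r ℕ.+ (s ℕ.+ s)))))
      (ℕ.n∣m*n (2 ℕ.* r))

    q∣r²+1 : q ∣ suc (r ℕ.* r)
    q∣r²+1 = ℕ.∣m+n∣m⇒∣n
      (subst (q ∣_) (trans (cong (λ x → suc (x ℕ.* x)) (ℕ.m≡m%n+[m/n]*n x q)) (identity₁ q r l)) q∣x²+1)
      (ℕ.n∣m*n (2 ℕ.* r ℕ.* l ℕ.+ l ℕ.* l ℕ.* q))

    go : ∀ {r} → Σ[ t ∈ ℕ ] (r ≡ t ℕ.+ t ⊎ r ≡ suc (t ℕ.+ t)) → r < q → q ∣ suc (r ℕ.* r) →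
         Σ[ t ∈ ℕ ] (t ℕ.+ t < q × q ∣ suc ((t ℕ.+ t) ℕ.* (t ℕ.+ t)))
    go (t , inj₁ refl) r<q q∣ = t , r<q , q∣
    go {r} (t , inj₂ refl) r<q q∣ = s , subst (s ℕ.+ s <_) r+2s≡q (ℕ.m<n+m (s ℕ.+ s) {suc (t ℕ.+ t)} ℕ.z<s) ,
      subst (_∣ suc ((s ℕ.+ s) ℕ.* (s ℕ.+ s))) r+2s≡q
        (reflected r s (subst (_∣ suc (r ℕ.* r)) (sym r+2s≡q) q∣))
      where
      -- Here q - r = (2c + 1) - (2t + 1) = 2s.
      s = c ℕ.∸ t

      t≤c : t ≤ c
      t≤c = ℕ.≮⇒≥ λ c<t → ℕ.<⇒≱ (subst (suc (t ℕ.+ t) <_) q≡ r<q)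
        (ℕ.s≤s (ℕ.+-mono-≤ (ℕ.<⇒≤ c<t) (ℕ.<⇒≤ c<t)))

      r+2s≡q : suc (t ℕ.+ t) ℕ.+ (s ℕ.+ s) ≡ q
      r+2s≡q = trans (identity₃ t s) (trans (cong (λ m → suc (m ℕ.+ m)) (ℕ.m+[n∸m]≡n t≤c)) (sym q≡))

  -- Descent: for even x < q, the cofactor of q in x² + 1 is again 3 modulo 4, and smaller than q.
  ∤x²+1 : ∀ q → q ℕ.% 4 ≡ 3 → ∀ x → ¬ q ∣ suc (x ℕ.* x)
  ∤x²+1 = <-rec _ step
    where
    step : ∀ q → (∀ {m} → m < q → m ℕ.% 4 ≡ 3 → ∀ x → ¬ m ∣ suc (x ℕ.* x)) →
           q ℕ.% 4 ≡ 3 → ∀ x → ¬ q ∣ suc (x ℕ.* x)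
    step zero _ ()
    step q@(suc q′) rec q%4≡3 x q∣x²+1 = descend (even-root q x (%4≡3⇒odd q q%4≡3) q∣x²+1)
     where
     descend : ¬ (Σ[ t ∈ ℕ ] (t ℕ.+ t < q × q ∣ suc ((t ℕ.+ t) ℕ.* (t ℕ.+ t))))
     descend (t , y<q , ℕ.divides m eq) = rec m<q m%4≡3 y (ℕ.divides q (trans eq (ℕ.*-comm m q)))
      where
      y = t ℕ.+ t

      identity : ∀ t → suc ((t ℕ.+ t) ℕ.* (t ℕ.+ t)) ≡ 1 ℕ.+ t ℕ.* t ℕ.* 4
      identity = solve-∀

      -- Since y is even, mq = y² + 1 is 1 modulo 4, while q is 3 modulo 4.
      m*3%4≡1 : (m ℕ.% 4 ℕ.* 3) ℕ.% 4 ≡ 1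
      m*3%4≡1 = begin
        (m ℕ.% 4 ℕ.* 3) ℕ.% 4         ≡⟨ cong (λ r → (m ℕ.% 4 ℕ.* r) ℕ.% 4) q%4≡3 ⟨
        (m ℕ.% 4 ℕ.* (q ℕ.% 4)) ℕ.% 4 ≡⟨ ℕ.%-distribˡ-* m q 4 ⟨
        (m ℕ.* q) ℕ.% 4               ≡⟨ cong (ℕ._% 4) (trans (sym eq) (identity t)) ⟩
        (1 ℕ.+ t ℕ.* t ℕ.* 4) ℕ.% 4   ≡⟨ ℕ.[m+kn]%n≡m%n 1 (t ℕ.* t) 4 ⟩
        1 ∎
        where open ≡-Reasoning

      solve-mod-4 : ∀ r → r < 4 → (r ℕ.* 3) ℕ.% 4 ≡ 1 → r ≡ 3
      solve-mod-4 0 _ ()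
      solve-mod-4 1 _ ()
      solve-mod-4 2 _ ()
      solve-mod-4 3 _ _ = refl
      solve-mod-4 (suc (suc (suc (suc r)))) (ℕ.s≤s (ℕ.s≤s (ℕ.s≤s (ℕ.s≤s ())))) _

      m%4≡3 : m ℕ.% 4 ≡ 3
      m%4≡3 = solve-mod-4 (m ℕ.% 4) (ℕ.m%n<n m 4) m*3%4≡1

      -- If q ≤ m, then q² ≤ mq = y² + 1; but y ≤ q - 1 and q > 1 give y² + 1 < q².
      m<q : m < q
      m<q = ℕ.≰⇒> λ q≤m → ℕ.<⇒≱ y²+1<q² (ℕ.≤-trans (ℕ.*-monoˡ-≤ q q≤m) (ℕ.≤-reflexive (sym eq)))
        where
        1≤q′ : 1 ≤ q′
        1≤q′ = ℕ.n≢0⇒n>0 λ { refl → contradiction q%4≡3 λ () }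

        y²+1<q² : suc (y ℕ.* y) < q ℕ.* q
        y²+1<q² = begin-strict
          suc (y ℕ.* y)              ≤⟨ ℕ.s≤s (ℕ.*-mono-≤ (ℕ.s≤s⁻¹ y<q) (ℕ.s≤s⁻¹ y<q)) ⟩
          suc (q′ ℕ.* q′)            <⟨ ℕ.s<s (ℕ.m<n+m (q′ ℕ.* q′) 1≤q′) ⟩
          suc (q′ ℕ.+ q′ ℕ.* q′)     ≤⟨ ℕ.s≤s (ℕ.m≤n+m _ q′) ⟩
          suc (q′ ℕ.+ (q′ ℕ.+ q′ ℕ.* q′)) ≡⟨ cong (λ z → suc (q′ ℕ.+ z)) (ℕ.*-suc q′ q′) ⟨
          q ℕ.* q                    ∎
          where open ℕ.≤-Reasoning

  prime-coprime : ∀ {p} → Prime p → ∀ {m} → ¬ p ∣ m → Coprime m p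
  prime-coprime pr p∤m (d∣m , d∣p) with prime⇒irreducible pr d∣p
  ... | inj₁ d≡1  = d≡1
  ... | inj₂ refl = contradiction d∣m p∤m

  -- If p did not divide b, a Bézout coefficient x with xb ≡ ±1 modulo p would give (ax)² + 1 ≡
  -- x²(a² + b²) ≡ 0, against `∤x²+1`. The two signs are the two forms of the Bézout identity over
  -- ℕ.
  ∣a²+b²⇒∣b : ∀ {p} → Prime p → p ℕ.% 4 ≡ 3 → ∀ a b → p ∣ a ℕ.* a ℕ.+ b ℕ.* b → p ∣ b
  ∣a²+b²⇒∣b {p} pr p%4≡3 a b p∣ with p ∣? b
  ... | yes p∣b = p∣b
  ... | no  p∤b with coprime-Bézout (prime-coprime pr p∤b)
  ...   | Bézout.+- x y eq = contradiction
    (ℕ.∣m+n∣m⇒∣n (subst (p ∣_) (trans (identity₁ a b x)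
       (trans (cong (λ z → a ℕ.* x ℕ.* (a ℕ.* x) ℕ.+ z ℕ.* z) (sym eq)) (identity₂ (a ℕ.* x) y p)))
       (ℕ.∣m⇒∣m*n (x ℕ.* x) p∣))
      (ℕ.n∣m*n (2 ℕ.* y ℕ.+ y ℕ.* y ℕ.* p)))
    (∤x²+1 p p%4≡3 (a ℕ.* x))
    where
    identity₁ : ∀ a b x → (a ℕ.* a ℕ.+ b ℕ.* b) ℕ.* (x ℕ.* x) ≡
                a ℕ.* x ℕ.* (a ℕ.* x) ℕ.+ x ℕ.* b ℕ.* (x ℕ.* b)
    identity₁ = solve-∀
    identity₂ : ∀ z y p → z ℕ.* z ℕ.+ (1 ℕ.+ y ℕ.* p) ℕ.* (1 ℕ.+ y ℕ.* p) ≡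
                (2 ℕ.* y ℕ.+ y ℕ.* y ℕ.* p) ℕ.* p ℕ.+ suc (z ℕ.* z)
    identity₂ = solve-∀
  ...   | Bézout.-+ x y eq = contradiction
    (ℕ.∣m+n∣m⇒∣n (subst (p ∣_) (identity a b x)
       (ℕ.∣m∣n⇒∣m+n (ℕ.∣m⇒∣m*n (x ℕ.* x) p∣) (ℕ.∣n⇒∣m*n 2 p∣1+xb)))
       (ℕ.∣m⇒∣m*n (1 ℕ.+ x ℕ.* b) p∣1+xb))
    (∤x²+1 p p%4≡3 (a ℕ.* x))
    where
    p∣1+xb : p ∣ 1 ℕ.+ x ℕ.* b
    p∣1+xb = ℕ.divides y eq
    identity : ∀ a b x → (a ℕ.* a ℕ.+ b ℕ.* b) ℕ.* (x ℕ.* x) ℕ.+ 2 ℕ.* (1 ℕ.+ x ℕ.* b) ≡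
               (1 ℕ.+ x ℕ.* b) ℕ.* (1 ℕ.+ x ℕ.* b) ℕ.+ suc (a ℕ.* x ℕ.* (a ℕ.* x))
    identity = solve-∀

  -- Units modulo powers of p.

  coprime⇒Unit : ∀ {m n} → Coprime m n → Unit ⌜ n ⌝ ⌜ m ⌝
  coprime⇒Unit {m} {n} c with coprime-Bézout c
  ... | Bézout.+- x y eq = ⌜ x ⌝ , by ⌜ y ⌝ (begin
    ⌜ m ⌝ * ⌜ x ⌝          ≡⟨ trans (*-comm ⌜ m ⌝ ⌜ x ⌝) (sym (⌜⌝-* x m)) ⟩
    ⌜ x ℕ.* m ⌝            ≡⟨ cong ⌜_⌝ eq ⟨
    ⌜ 1 ℕ.+ y ℕ.* n ⌝      ≡⟨ trans (⌜⌝-+ 1 _) (cong (λ z → 1# + z) (trans (⌜⌝-* y n) (*-comm ⌜ y ⌝ ⌜ n ⌝))) ⟩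
    1# + ⌜ n ⌝ * ⌜ y ⌝     ∎)
    where open ≡-Reasoning
  ... | Bézout.-+ x y eq = - ⌜ x ⌝ , by (- ⌜ y ⌝) (begin
    ⌜ m ⌝ * - ⌜ x ⌝
      ≡⟨ solve 2 (λ m x → m :* :- x := con 1# :- (con 1# :+ x :* m)) refl ⌜ m ⌝ ⌜ x ⌝ ⟩
    1# - (1# + ⌜ x ⌝ * ⌜ m ⌝)
      ≡⟨ cong (λ z → 1# - z) (trans (cong (λ z → 1# + z) (sym (⌜⌝-* x m)))
           (trans (sym (⌜⌝-+ 1 (x ℕ.* m))) (trans (cong ⌜_⌝ eq) (⌜⌝-* y n)))) ⟩
    1# - ⌜ y ⌝ * ⌜ n ⌝
      ≡⟨ solve 2 (λ y n → con 1# :- y :* n := con 1# :+ n :* :- y) refl ⌜ y ⌝ ⌜ n ⌝ ⟩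
    1# + ⌜ n ⌝ * - ⌜ y ⌝ ∎)
    where open ≡-Reasoning

  -- A divisor of a unit is a unit, and x + iy divides its norm x² + y². The norm is prime to p,
  -- since otherwise p would divide both coordinates.
  Unit-gauss : ∀ {p} → Prime p → p ℕ.% 4 ≡ 3 → ∀ x y → ¬ (p ∣ x × p ∣ y) → Unit ⌜ p ⌝ (gauss x y)
  Unit-gauss {p} pr p%4≡3 x y p∤ = Unit-factor (gauss x y) {⌜ x ⌝ - i * ⌜ y ⌝}
    (Unit-resp (≈-reflexive (begin
      gauss x y * (⌜ x ⌝ - i * ⌜ y ⌝)
        ≡⟨ cong (_* (⌜ x ⌝ - i * ⌜ y ⌝)) (gauss-split x y) ⟩
      (⌜ x ⌝ + i * ⌜ y ⌝) * (⌜ x ⌝ - i * ⌜ y ⌝)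
        ≡⟨ solve 2 (λ x y → (x :+ con i :* y) :* (x :- con i :* y) := x :* x :+ y :* y) refl ⌜ x ⌝ ⌜ y ⌝ ⟩
      ⌜ x ⌝ * ⌜ x ⌝ + ⌜ y ⌝ * ⌜ y ⌝
        ≡⟨ trans (⌜⌝-+ (x ℕ.* x) (y ℕ.* y)) (cong₂ _+_ (⌜⌝-* x x) (⌜⌝-* y y)) ⟨
      ⌜ x ℕ.* x ℕ.+ y ℕ.* y ⌝ ∎))
    (coprime⇒Unit (prime-coprime pr λ p∣ → p∤
      ( ∣a²+b²⇒∣b pr p%4≡3 y x (subst (p ∣_) (ℕ.+-comm (x ℕ.* x) (y ℕ.* y)) p∣)
      , ∣a²+b²⇒∣b pr p%4≡3 x y p∣))))
    where open ≡-Reasoning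

  Unit-^ : ∀ {p z} → Unit ⌜ p ⌝ z → ∀ k → Unit ⌜ p ℕ.^ k ⌝ z
  Unit-^ {z = z} u zero = z , by (z * z - 1#) (solve 1 (λ z → z :* z := con 1# :+ con 1# :* (z :* z :- con 1#)) refl z)
  Unit-^ {p} u (suc k) = subst (λ d → Unit d _) (sym (⌜⌝-* p (p ℕ.^ k))) (Unit-mod-* u (Unit-^ u k))

  -- Rectangular products and their factors divisible by p.

  -- The common shape of both products in 𝓡(A, B; C, D): the denominator is the value at z = 0, the
  -- numerator the value at z = (A - C) + i(B - D).
  Ψ : ℕ → ℕ → ℤ [i] → ℤ [i]
  Ψ C D z = ∏ C λ x → ∏ D λ y → z + gauss (suc x) (suc y)

  Ψ′ : ℕ → ℕ → ℕ → ℤ [i] → ℤ [i]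
  Ψ′ p C D z = ∏ C λ x → ∏ D λ y → coprimeFactor p z (suc x) (suc y)

  ∏-blocks₂ : ∀ C D n (f : ℕ → ℕ → ℤ [i]) → ∏ (C ℕ.* n) (λ x → ∏ (D ℕ.* n) (f x)) ≡
              ∏ C λ c → ∏ D λ d → ∏ n λ x → ∏ n λ y → f (c ℕ.* n ℕ.+ x) (d ℕ.* n ℕ.+ y)
  ∏-blocks₂ C D n f = trans (∏-blocks C n _) (∏-cong C λ c _ →
    trans (∏-cong n λ x _ → ∏-blocks D n _) (∏-comm n D _))

  ∏-const : ∀ n m → ∏ n (λ _ → ⌜ m ⌝) ≡ ⌜ m ℕ.^ n ⌝
  ∏-const zero    m = refl
  ∏-const (suc n) m = trans (cong (_* ⌜ m ⌝) (∏-const n m))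
    (trans (*-comm _ ⌜ m ⌝) (sym (⌜⌝-* m (m ℕ.^ n))))

  ∏-const₂ : ∀ C D m → ∏ C (λ _ → ∏ D λ _ → ⌜ m ⌝) ≡ ⌜ (m ℕ.^ D) ℕ.^ C ⌝
  ∏-const₂ C D m = trans (∏-cong C λ _ _ → ∏-const D m) (∏-const C (m ℕ.^ D))

  gauss-scale : ∀ p x y → gauss (x ℕ.* p) (y ℕ.* p) ≡ ⌜ p ⌝ * gauss x y
  gauss-scale p x y rewrite gauss-split (x ℕ.* p) (y ℕ.* p) | gauss-split x y | ⌜⌝-* x p | ⌜⌝-* y p =
    solve 3 (λ p x y → x :* p :+ con i :* (y :* p) := p :* (x :+ con i :* y)) refl ⌜ p ⌝ ⌜ x ⌝ ⌜ y ⌝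

  omit*keep : ∀ {P} (P? : Dec P) z → omit P? z * keep P? z ≡ z
  omit*keep (yes _) z = *-identityˡ z
  omit*keep (no _)  z = *-identityʳ z

  keep-yes : ∀ {P} (P? : Dec P) {z} → P → keep P? z ≡ z
  keep-yes (yes _) _ = refl
  keep-yes (no ¬p) p = contradiction p ¬p

  keep-no : ∀ {P} (P? : Dec P) {z} → ¬ P → keep P? z ≡ 1#
  keep-no (yes p) ¬p = contradiction p ¬p
  keep-no (no _)  _  = refl

  keep-× : ∀ {P Q} (P? : Dec P) (Q? : Dec Q) z → keep (P? ×-dec Q?) z ≡ keep P? (keep Q? z)
  keep-× (yes _) (yes _) z = refl
  keep-× (yes _) (no _)  z = refl
  keep-× (no _)  Q?      z = refl

  keep-∏ : ∀ {P} (P? : Dec P) n f → ∏ n (λ j → keep P? (f j)) ≡ keep P? (∏ n f)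
  keep-∏ (yes _) n f = refl
  keep-∏ (no _)  n f = ∏-1 n λ _ _ → refl

  -- Values start at 1, so the multiple of p is the last entry of each complete block of length p,
  -- and the r < p remaining entries contain none.
  ∏-multiples : ∀ p {r} C (f : ℕ → ℤ [i]) → r < p →
    ∏ (C ℕ.* p ℕ.+ r) (λ x → keep (p ∣? suc x) (f (suc x))) ≡ ∏ C (λ c → f (suc c ℕ.* p))
  ∏-multiples p@(suc p′) {r} C f r<p = begin
    ∏ (C ℕ.* p ℕ.+ r) g
      ≡⟨ ∏-+ (C ℕ.* p) r g ⟩
    ∏ (C ℕ.* p) g * ∏ r (λ j → g (C ℕ.* p ℕ.+ j))
      ≡⟨ cong₂ _*_ (∏-blocks C p g) (∏-1 r λ j j<r → g-no C j (ℕ.≤-<-trans j<r r<p)) ⟩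
    ∏ C (λ c → ∏ p λ j → g (c ℕ.* p ℕ.+ j)) * 1#
      ≡⟨ *-identityʳ _ ⟩
    ∏ C (λ c → ∏ p λ j → g (c ℕ.* p ℕ.+ j))
      ≡⟨ ∏-cong C (λ c _ → trans (cong₂ _*_ (∏-1 p′ λ j j<p′ → g-no c j (ℕ.s≤s j<p′)) (g-yes c))
           (*-identityˡ _)) ⟩
    ∏ C (λ c → f (suc c ℕ.* p)) ∎
    where
    open ≡-Reasoning
    g : ℕ → ℤ [i]
    g x = keep (p ∣? suc x) (f (suc x))

    g-no : ∀ c j → suc j < p → g (c ℕ.* p ℕ.+ j) ≡ 1#
    g-no c j j<p = keep-no (p ∣? suc (c ℕ.* p ℕ.+ j)) λ p∣ → ℕ.>⇒∤ j<p
      (ℕ.∣m+n∣m⇒∣n (subst (p ∣_) (sym (ℕ.+-suc (c ℕ.* p) j)) p∣) (ℕ.n∣m*n c))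

    last : ∀ c → suc (c ℕ.* p ℕ.+ p′) ≡ suc c ℕ.* p
    last c = trans (sym (ℕ.+-suc (c ℕ.* p) p′)) (ℕ.+-comm (c ℕ.* p) p)

    g-yes : ∀ c → g (c ℕ.* p ℕ.+ p′) ≡ f (suc c ℕ.* p)
    g-yes c = trans (cong (λ x → keep (p ∣? x) (f x)) (last c))
      (keep-yes (p ∣? (suc c ℕ.* p)) (ℕ.n∣m*n (suc c)))

  ∏-multiples₂ : ∀ p {r s} C D (f : ℕ → ℕ → ℤ [i]) → r < p → s < p →
    ∏ (C ℕ.* p ℕ.+ r) (λ x → ∏ (D ℕ.* p ℕ.+ s) λ y → keep (p ∣? suc x ×-dec p ∣? suc y) (f (suc x) (suc y)))
    ≡ ∏ C (λ c → ∏ D λ d → f (suc c ℕ.* p) (suc d ℕ.* p))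
  ∏-multiples₂ p {r} {s} C D f r<p s<p = trans
    (∏-cong (C ℕ.* p ℕ.+ r) λ x _ → trans
      (∏-cong (D ℕ.* p ℕ.+ s) λ y _ → keep-× (p ∣? suc x) (p ∣? suc y) _)
      (trans (keep-∏ (p ∣? suc x) (D ℕ.* p ℕ.+ s) _)
        (cong (keep (p ∣? suc x)) (∏-multiples p D (f (suc x)) s<p))))
    (∏-multiples p C (λ x → ∏ D λ d → f x (suc d ℕ.* p)) r<p)

  -- A factor is kept apart exactly when both coordinates are multiples of p. It then equals p(z + c
  -- + id), so these factors give one p for each point of the smaller rectangle, times its product.
  Ψ-split : ∀ p {r s} C D z → r < p → s < p → let C′ = C ℕ.* p ℕ.+ r ; D′ = D ℕ.* p ℕ.+ s in
    Ψ C′ D′ (⌜ p ⌝ * z) ≡ Ψ′ p C′ D′ (⌜ p ⌝ * z) * (⌜ (p ℕ.^ D) ℕ.^ C ⌝ * Ψ C D z)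
  Ψ-split p {r} {s} C D z r<p s<p = begin
    Ψ C′ D′ (⌜ p ⌝ * z)
      ≡⟨ ∏-cong₂ C′ D′ (λ x y _ _ → omit*keep (p ∣? suc x ×-dec p ∣? suc y) _) ⟨
    ∏ C′ (λ x → ∏ D′ λ y → coprimeFactor p (⌜ p ⌝ * z) (suc x) (suc y) *
      keep (p ∣? suc x ×-dec p ∣? suc y) (⌜ p ⌝ * z + gauss (suc x) (suc y)))
      ≡⟨ ∏-*₂ C′ D′ _ _ ⟩
    Ψ′ p C′ D′ (⌜ p ⌝ * z) * _
      ≡⟨ cong (Ψ′ p C′ D′ (⌜ p ⌝ * z) *_)
           (∏-multiples₂ p C D (λ x y → ⌜ p ⌝ * z + gauss x y) r<p s<p) ⟩
    Ψ′ p C′ D′ (⌜ p ⌝ * z) * ∏ C (λ c → ∏ D λ d → ⌜ p ⌝ * z + gauss (suc c ℕ.* p) (suc d ℕ.* p))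
      ≡⟨ cong (Ψ′ p C′ D′ (⌜ p ⌝ * z) *_) (trans
           (∏-cong₂ C D λ c d _ _ → trans (cong (λ u → ⌜ p ⌝ * z + u) (gauss-scale p (suc c) (suc d)))
             (solve 3 (λ p z u → p :* z :+ p :* u := p :* (z :+ u)) refl ⌜ p ⌝ z (gauss (suc c) (suc d))))
           (trans (∏-*₂ C D _ _) (cong (_* Ψ C D z) (∏-const₂ C D p)))) ⟩
    Ψ′ p C′ D′ (⌜ p ⌝ * z) * (⌜ (p ℕ.^ D) ℕ.^ C ⌝ * Ψ C D z) ∎
    where
    open ≡-Reasoning
    C′ = C ℕ.* p ℕ.+ r
    D′ = D ℕ.* p ℕ.+ s

  -- Divisibility and p-integrality.

  infix 4 _∣ᵢ_
  _∣ᵢ_ : ℤ [i] → ℤ [i] → Set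
  d ∣ᵢ z = Σ[ q ∈ ℤ [i] ] z ≡ d * q

  ∣ᵢ-trans : ∀ {a b c} → a ∣ᵢ b → b ∣ᵢ c → a ∣ᵢ c
  ∣ᵢ-trans {a} (q , refl) (r , refl) = q * r , *-assoc a q r

  ∏-∣ᵢ : ∀ n {f g} → (∀ j → f j ∣ᵢ g j) → ∏ n f ∣ᵢ ∏ n g
  ∏-∣ᵢ n {f} f∣g = ∏ n (proj₁ ∘ f∣g) , trans (∏-cong n λ j _ → proj₂ (f∣g j)) (∏-* n f (proj₁ ∘ f∣g))

  factor-∣ᵢ : ∀ n f {j} → j < n → f j ∣ᵢ ∏ n f
  factor-∣ᵢ (suc n) f {j} (ℕ.s≤s j≤n) with ℕ.m≤n⇒m<n∨m≡n j≤n
  ... | inj₁ j<n  = ∣ᵢ-trans (factor-∣ᵢ n f j<n) (f n , refl)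
  ... | inj₂ refl = ∏ n f , *-comm (∏ n f) (f n)

  progression-∣ᵢ : ∀ p {r j} C f → j < p → ∏ C (λ c → f (c ℕ.* p ℕ.+ j)) ∣ᵢ ∏ (C ℕ.* p ℕ.+ r) f
  progression-∣ᵢ p {r} {j} C f j<p = ∣ᵢ-trans
    (subst (∏ C (λ c → f (c ℕ.* p ℕ.+ j)) ∣ᵢ_) (sym (∏-blocks C p f)) (∏-∣ᵢ C λ c → factor-∣ᵢ p (λ x → f (c ℕ.* p ℕ.+ x)) j<p))
    (_ , ∏-+ (C ℕ.* p) r f)

  ℤ-next-multiple : ∀ p .{{_ : ℕ.NonZero p}} a → Σ[ x ∈ ℕ ] Σ[ w ∈ ℤ ] x < p × a ℤ.+ + suc x ≡ + p ℤ.* w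
  ℤ-next-multiple p a = x , ℤ.- q , ℤ.n%ℕd<d b p , (begin
    a ℤ.+ + suc x                ≡⟨ S.solve 2 (λ a x → a S.:+ (S.con (+ 1) S.:+ x) S.:=
                                      x S.:- (S.:- a S.:- S.con (+ 1))) refl a (+ x) ⟩
    + x ℤ.- b                    ≡⟨ cong (ℤ._-_ (+ x)) (ℤ.a≡a%ℕn+[a/ℕn]*n b p) ⟩
    + x ℤ.- (+ x ℤ.+ q ℤ.* + p)  ≡⟨ S.solve 3 (λ x q p → x S.:- (x S.:+ q S.:* p) S.:=
                                      p S.:* (S.:- q)) refl (+ x) q (+ p) ⟩
    + p ℤ.* ℤ.- q                ∎)
    where
    open ≡-Reasoning
    -- Reducing -a - 1 makes the summand x + 1 lie in 1, ..., p, in line with products whose values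
    -- start at 1.
    b = ℤ.- a ℤ.- + 1
    x = b ℤ.%ℕ p
    q = b ℤ./ℕ p

  opaque
    unfolding _+_ _*_

    next-multiple : ∀ p .{{_ : ℕ.NonZero p}} z → Σ[ x ∈ ℕ ] Σ[ y ∈ ℕ ] Σ[ w ∈ ℤ [i] ]
                    x < p × y < p × z + gauss (suc x) (suc y) ≡ ⌜ p ⌝ * w
    next-multiple p z =
      let x , v , x<p , x≡ = ℤ-next-multiple p (re z)
          y , w , y<p , y≡ = ℤ-next-multiple p (im z)
      in x , y , v +i w , x<p , y<p , cong₂ _+i_
           (trans x≡ (sym (ℤ.+-identityʳ _))) (trans y≡ (sym (ℤ.+-identityʳ _)))

  -- Among any p consecutive columns (rows) one is ≡ 0 modulo p.
  Ψ-divisible : ∀ p .{{_ : ℕ.NonZero p}} {r s} C D z →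
    Σ[ w ∈ ℤ [i] ] ⌜ (p ℕ.^ D) ℕ.^ C ⌝ * Ψ C D w ∣ᵢ Ψ (C ℕ.* p ℕ.+ r) (D ℕ.* p ℕ.+ s) z
  Ψ-divisible p {r} {s} C D z with x , y , u , x<p , y<p , eq ← next-multiple p z =
    -- Blocks are numbered from (0, 0) but the values in `Ψ` start at 1 + i, which is compensated
    -- here.
    u - gauss 1 1 , subst (_∣ᵢ Ψ (C ℕ.* p ℕ.+ r) (D ℕ.* p ℕ.+ s) z) (begin
      ∏ C (λ c → ∏ D λ d → z + gauss (suc (c ℕ.* p ℕ.+ x)) (suc (d ℕ.* p ℕ.+ y)))
        ≡⟨ ∏-cong₂ C D (λ c d _ _ → term c d) ⟩
      ∏ C (λ c → ∏ D λ d → ⌜ p ⌝ * (u - gauss 1 1 + gauss (suc c) (suc d)))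
        ≡⟨ trans (∏-*₂ C D _ _) (cong (_* Ψ C D (u - gauss 1 1)) (∏-const₂ C D p)) ⟩
      ⌜ (p ℕ.^ D) ℕ.^ C ⌝ * Ψ C D (u - gauss 1 1) ∎)
    (∣ᵢ-trans
      (∏-∣ᵢ C λ c → progression-∣ᵢ p D (λ y′ → z + gauss (suc (c ℕ.* p ℕ.+ x)) (suc y′)) y<p)
      (progression-∣ᵢ p C (λ x′ → ∏ (D ℕ.* p ℕ.+ s) λ y′ → z + gauss (suc x′) (suc y′)) x<p))
    where
    open ≡-Reasoning
    term : ∀ c d → z + gauss (suc (c ℕ.* p ℕ.+ x)) (suc (d ℕ.* p ℕ.+ y)) ≡
                   ⌜ p ⌝ * (u - gauss 1 1 + gauss (suc c) (suc d))
    term c d = begin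
      z + gauss (suc (c ℕ.* p ℕ.+ x)) (suc (d ℕ.* p ℕ.+ y))
        ≡⟨ cong₂ (λ m n → z + gauss m n) (sym (ℕ.+-suc (c ℕ.* p) x)) (sym (ℕ.+-suc (d ℕ.* p) y)) ⟩
      z + gauss (c ℕ.* p ℕ.+ suc x) (d ℕ.* p ℕ.+ suc y)
        ≡⟨ cong (λ u → z + u) (trans (gauss-+ (c ℕ.* p) (suc x) (d ℕ.* p) (suc y))
             (cong (_+ gauss (suc x) (suc y)) (gauss-scale p c d))) ⟩
      z + (⌜ p ⌝ * gauss c d + gauss (suc x) (suc y))
        ≡⟨ solve 3 (λ z a b → z :+ (a :+ b) := a :+ (z :+ b)) refl z _ _ ⟩
      ⌜ p ⌝ * gauss c d + (z + gauss (suc x) (suc y))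
        ≡⟨ cong (λ v → ⌜ p ⌝ * gauss c d + v) eq ⟩
      ⌜ p ⌝ * gauss c d + ⌜ p ⌝ * u
        ≡⟨ solve 4 (λ p g u e → p :* g :+ p :* u := p :* (u :- e :+ (e :+ g))) refl ⌜ p ⌝ (gauss c d) u (gauss 1 1) ⟩
      ⌜ p ⌝ * (u - gauss 1 1 + (gauss 1 1 + gauss c d))
        ≡⟨ cong (λ v → ⌜ p ⌝ * (u - gauss 1 1 + v)) (gauss-+ 1 c 1 d) ⟨
      ⌜ p ⌝ * (u - gauss 1 1 + gauss (suc c) (suc d)) ∎

  module Integrality {p : ℕ} .{{_ : ℕ.NonZero p}} (1<p : 1 < p)
    (unit : ∀ x y → ¬ (p ∣ x × p ∣ y) → Unit ⌜ p ⌝ (gauss x y)) where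

    Unit-Ψ′ : ∀ C D z → Unit ⌜ p ⌝ (Ψ′ p C D (⌜ p ⌝ * z))
    Unit-Ψ′ C D z = Unit-∏ C λ x _ → Unit-∏ D λ y _ → Unit-omit (p ∣? suc x ×-dec p ∣? suc y) λ p∤ →
      Unit-resp (by z (solve 3 (λ p z u → p :* z :+ u := u :+ p :* z) refl ⌜ p ⌝ z (gauss (suc x) (suc y))))
        (unit (suc x) (suc y) p∤)

    -- Comparing p-adic valuations through the integer q makes the coefficient p-integral.
    record Content (C D : ℕ) : Set where
      field
        q           : ℕ
        q-nonZero   : ℕ.NonZero q
        unitPart    : ℤ [i]
        isUnit      : Unit ⌜ p ⌝ unitPart
        Ψ0≡         : Ψ C D 0# ≡ ⌜ q ⌝ * unitPart
        divides     : ∀ z → ⌜ q ⌝ ∣ᵢ Ψ C D z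

    -- Recursion from C to ⌊C/p⌋, with D arbitrary. At z = 0 the factors divisible by p yield
    -- exactly e times the smaller product, by `Ψ-split`, the rest being a unit; at any z,
    -- `Ψ-divisible` yields at least e times a smaller product.
    content : ∀ C D → Content C D
    content = <-rec _ step
      where
      step : ∀ C → (∀ {C₀} → C₀ < C → ∀ D → Content C₀ D) → ∀ D → Content C D
      step zero _ D = record
        { q = 1 ; unitPart = 1# ; isUnit = Unit-1 ; Ψ0≡ = sym (*-identityˡ 1#)
        ; divides = λ _ → 1# , sym (*-identityˡ 1#) }
      step C@(suc _) rec D = subst₂ Content
        (trans (ℕ.+-comm (C₀ ℕ.* p) r) (sym (ℕ.m≡m%n+[m/n]*n C p)))
        (trans (ℕ.+-comm (D₀ ℕ.* p) s) (sym (ℕ.m≡m%n+[m/n]*n D p)))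
        (record
          { q = e ℕ.* q
          ; q-nonZero = ℕ.m*n≢0 e q {{ℕ.m^n≢0 (p ℕ.^ D₀) C₀ {{ℕ.m^n≢0 p D₀}}}} {{q-nonZero}}
          ; unitPart = U * unitPart
          ; isUnit = Unit-* (Unit-Ψ′ C′ D′ 0#) isUnit
          ; Ψ0≡ = begin
              Ψ C′ D′ 0#                  ≡⟨ cong (Ψ C′ D′) (zeroʳ ⌜ p ⌝) ⟨
              Ψ C′ D′ (⌜ p ⌝ * 0#)        ≡⟨ Ψ-split p C₀ D₀ 0# (ℕ.m%n<n C p) (ℕ.m%n<n D p) ⟩
              U * (⌜ e ⌝ * Ψ C₀ D₀ 0#)    ≡⟨ cong (λ v → U * (⌜ e ⌝ * v)) Ψ0≡ ⟩
              U * (⌜ e ⌝ * (⌜ q ⌝ * unitPart))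
                ≡⟨ solve 4 (λ U e q M → U :* (e :* (q :* M)) := (e :* q) :* (U :* M)) refl U ⌜ e ⌝ ⌜ q ⌝ unitPart ⟩
              (⌜ e ⌝ * ⌜ q ⌝) * (U * unitPart) ≡⟨ cong (_* (U * unitPart)) (⌜⌝-* e q) ⟨
              ⌜ e ℕ.* q ⌝ * (U * unitPart) ∎
          ; divides = λ z → let w , d = Ψ-divisible p C₀ D₀ z ; t , eq = divides w in
              ∣ᵢ-trans (t , trans (cong (⌜ e ⌝ *_) eq)
                (trans (sym (*-assoc ⌜ e ⌝ ⌜ q ⌝ t)) (cong (_* t) (sym (⌜⌝-* e q))))) d
          })
        where
        open ≡-Reasoning
        C₀ = C ℕ./ p
        D₀ = D ℕ./ p
        r  = C ℕ.% p
        s  = D ℕ.% p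
        C′ = C₀ ℕ.* p ℕ.+ r
        D′ = D₀ ℕ.* p ℕ.+ s
        e  = (p ℕ.^ D₀) ℕ.^ C₀
        U  = Ψ′ p C′ D′ (⌜ p ⌝ * 0#)
        open Content (rec (ℕ.m/n<m C p 1<p) D₀)

  -- Unit products over rectangles tiled by squares.

  module _ (p h : ℕ) (p∣n : p ∣ suc (h ℕ.+ h))
    (p-odd : ∀ j → p ∣ j ℕ.+ j → p ∣ j)
    (unit : ∀ x y → ¬ (p ∣ x × p ∣ y) → Unit ⌜ suc (h ℕ.+ h) ⌝ (gauss x y))
    (unit-2 : Unit ⌜ suc (h ℕ.+ h) ⌝ 2#) (unit-3 : Unit ⌜ suc (h ℕ.+ h) ⌝ 3#) where

    private
      n = suc (h ℕ.+ h)
      N = ⌜ n ⌝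
      open Square p (h ℕ.+ h) h refl p∣n p-odd unit unit-2 unit-3

      ∣-shift : ∀ {x} c → p ∣ c ℕ.* n ℕ.+ x → p ∣ x
      ∣-shift c d = ℕ.∣m+n∣m⇒∣n d (ℕ.∣n⇒∣m*n c p∣n)

      ∣-unshift : ∀ {x} c → p ∣ x → p ∣ c ℕ.* n ℕ.+ x
      ∣-unshift c = ℕ.∣m∣n⇒∣m+n (ℕ.∣n⇒∣m*n c p∣n)

      coprimeFactor-shift : ∀ w c d x y →
        coprimeFactor p (N * w) (c ℕ.* n ℕ.+ x) (d ℕ.* n ℕ.+ y) ≡ coprimeFactor p (N * (w + gauss c d)) x y
      coprimeFactor-shift w c d x y = omit-cong (p ∣? (c ℕ.* n ℕ.+ x) ×-dec p ∣? (d ℕ.* n ℕ.+ y))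
        (p ∣? x ×-dec p ∣? y)
        (λ (a , b) → ∣-shift c a , ∣-shift d b) (λ (a , b) → ∣-unshift c a , ∣-unshift d b)
        λ _ → begin
          N * w + gauss (c ℕ.* n ℕ.+ x) (d ℕ.* n ℕ.+ y)
            ≡⟨ cong (λ u → N * w + u) (trans (gauss-+ (c ℕ.* n) x (d ℕ.* n) y)
                 (cong (_+ gauss x y) (gauss-scale n c d))) ⟩
          N * w + (N * gauss c d + gauss x y)
            ≡⟨ solve 4 (λ n w g u → n :* w :+ (n :* g :+ u) := n :* (w :+ g) :+ u) refl N w (gauss c d) (gauss x y) ⟩
          N * (w + gauss c d) + gauss x y ∎
        where open ≡-Reasoning

      -- The square in position (c, d) is the standard one translated by n(c + id). The translation
      -- only changes w, and it preserves divisibility of the coordinates by p because p divides n.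
      Ψ′-squares : ∀ C D w → Ψ′ p (C ℕ.* n) (D ℕ.* n) (N * w) ≡ ∏ C λ c → ∏ D λ d → square (w + gauss c d)
      Ψ′-squares C D w = trans (∏-blocks₂ C D n _) (∏-cong₂ C D λ c d _ _ → ∏-cong₂ n n λ x y _ _ →
        trans (cong₂ (coprimeFactor p (N * w)) (sym (ℕ.+-suc (c ℕ.* n) x)) (sym (ℕ.+-suc (d ℕ.* n) y)))
              (coprimeFactor-shift w c d (suc x) (suc y)))

    Ψ′-constant : ∀ C D w → Ψ′ p (C ℕ.* n) (D ℕ.* n) (N * w) ≈ Ψ′ p (C ℕ.* n) (D ℕ.* n) 0# mod N * N * N
    Ψ′-constant C D w = begin
      Ψ′ p (C ℕ.* n) (D ℕ.* n) (N * w)              ≡⟨ Ψ′-squares C D w ⟩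
      ∏ C (λ c → ∏ D λ d → square (w + gauss c d))  ≈⟨ constant w ⟩
      ∏ C (λ c → ∏ D λ d → square 0#)               ≈⟨ constant 0# ⟨
      ∏ C (λ c → ∏ D λ d → square (0# + gauss c d)) ≡⟨ Ψ′-squares C D 0# ⟨
      Ψ′ p (C ℕ.* n) (D ℕ.* n) (N * 0#)             ≡⟨ cong (Ψ′ p (C ℕ.* n) (D ℕ.* n)) (zeroʳ N) ⟩
      Ψ′ p (C ℕ.* n) (D ℕ.* n) 0#                   ∎
      where
      open SetoidReasoning (≈-setoid (N * N * N))
      constant : ∀ w → ∏ C (λ c → ∏ D λ d → square (w + gauss c d)) ≈
                       ∏ C (λ c → ∏ D λ d → square 0#) mod N * N * N
      constant w = ∏-≈ C λ c _ → ∏-≈ D λ d _ → square-constant (w + gauss c d)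

  -- The two fractions X / Y and x / y become U₁ x′ / (U₂ M) and x′ / M after cancelling
  -- the integers s and q.
  record CongruentFractions (p : ℕ) (d X Y x y : ℤ [i]) : Set where
    field
      s q           : ℕ
      s-nonZero     : ℕ.NonZero s
      q-nonZero     : ℕ.NonZero q
      U₁ U₂ M x′    : ℤ [i]
      X≡            : X ≡ ⌜ s ⌝ * (U₁ * x′)
      Y≡            : Y ≡ ⌜ s ⌝ * (U₂ * M)
      x≡            : x ≡ ⌜ q ⌝ * x′
      y≡            : y ≡ ⌜ q ⌝ * M
      U₁≈U₂         : U₁ ≈ U₂ mod d
      isUnit        : Unit ⌜ p ⌝ (U₂ * M)

  -- Comparison of two consecutive levels.

  module _ {p : ℕ} (pr : Prime p) (5<p : 5 < p) (p%4≡3 : p ℕ.% 4 ≡ 3) where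

    private
      instance
        p≢0 : ℕ.NonZero p
        p≢0 = ℕ.>-nonZero (ℕ.≤-trans (ℕ.s≤s ℕ.z≤n) 5<p)

      p∤ : ∀ {m} .{{_ : ℕ.NonZero m}} → m ≤ 5 → ¬ p ∣ m
      p∤ m≤5 = ℕ.>⇒∤ (ℕ.≤-<-trans m≤5 5<p)

      unit : ∀ x y → ¬ (p ∣ x × p ∣ y) → Unit ⌜ p ⌝ (gauss x y)
      unit = Unit-gauss pr p%4≡3

      p-odd : ∀ j → p ∣ j ℕ.+ j → p ∣ j
      p-odd j p∣2j with euclidsLemma 2 j pr (subst (λ m → p ∣ j ℕ.+ m) (sym (ℕ.+-identityʳ j)) p∣2j)
      ... | inj₁ p∣2 = contradiction p∣2 (p∤ (ℕ.s≤s (ℕ.s≤s ℕ.z≤n)))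
      ... | inj₂ p∣j = p∣j

      unit-small : ∀ m .{{_ : ℕ.NonZero m}} → m ≤ 5 → Unit ⌜ p ⌝ ⌜ m ⌝
      unit-small m m≤5 = unit m 0 (p∤ m≤5 ∘ proj₁)

      open Integrality {p} (ℕ.≤-trans (ℕ.s≤s (ℕ.s≤s ℕ.z≤n)) 5<p) unit

    Ψ′-constant-odd : ∀ n → Odd n → p ∣ n → (∀ {z} → Unit ⌜ p ⌝ z → Unit ⌜ n ⌝ z) → ∀ C D w → let N = ⌜ n ⌝ in
      Ψ′ p (C ℕ.* n) (D ℕ.* n) (N * w) ≈ Ψ′ p (C ℕ.* n) (D ℕ.* n) 0# mod N * N * N
    Ψ′-constant-odd n (h , refl) p∣n unit-n = Ψ′-constant p h p∣n p-odd (λ x y p∤xy → unit-n (unit x y p∤xy))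
      (unit-n (unit-small 2 (ℕ.s≤s (ℕ.s≤s ℕ.z≤n)))) (unit-n (unit-small 3 (ℕ.s≤s (ℕ.s≤s (ℕ.s≤s ℕ.z≤n)))))

    -- `content` at the lower level provides the integer q and the unit M. `Ψ-split` with both
    -- remainders 0 expresses the upper level through the lower one, so there the integer to cancel
    -- is eq and the only new factors are the unit products U₁ and U₂.
    Ψ-congruentFractions : ∀ k C D w → let m = p ℕ.^ k ; n = p ℕ.^ suc k ; N = ⌜ n ⌝ in
      CongruentFractions p ⌜ p ℕ.^ (3 ℕ.* suc k) ⌝
        (Ψ (C ℕ.* n) (D ℕ.* n) (N * w)) (Ψ (C ℕ.* n) (D ℕ.* n) 0#)
        (Ψ (C ℕ.* m) (D ℕ.* m) (⌜ m ⌝ * w)) (Ψ (C ℕ.* m) (D ℕ.* m) 0#)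
    Ψ-congruentFractions k C D w = record
      { s = e ℕ.* q
      ; q = q
      ; s-nonZero = ℕ.m*n≢0 e q {{ℕ.m^n≢0 (p ℕ.^ D₀) C₀ {{ℕ.m^n≢0 p D₀}}}} {{q-nonZero}}
      ; q-nonZero = q-nonZero
      ; U₁ = Ψ′ p C′ D′ (N * w)
      ; U₂ = Ψ′ p C′ D′ 0#
      ; M  = unitPart
      ; x′ = proj₁ (divides (⌜ m ⌝ * w))
      ; X≡ = trans (cong (Ψ C′ D′) N*) (split (⌜ m ⌝ * w) (sym N*) (proj₂ (divides (⌜ m ⌝ * w))))
      ; Y≡ = trans (cong (Ψ C′ D′) (sym (zeroʳ ⌜ p ⌝))) (split 0# (zeroʳ ⌜ p ⌝) Ψ0≡)
      ; x≡ = proj₂ (divides (⌜ m ⌝ * w))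
      ; y≡ = Ψ0≡
      ; U₁≈U₂ = subst (λ d → Ψ′ p C′ D′ (N * w) ≈ Ψ′ p C′ D′ 0# mod d) cube
          (Ψ′-constant-odd n (odd-^ (%4≡3⇒odd p p%4≡3) (suc k)) (ℕ.m∣m*n m) (λ u → Unit-^ u (suc k)) C D w)
      ; isUnit = Unit-* (subst (λ z → Unit ⌜ p ⌝ (Ψ′ p C′ D′ z)) (zeroʳ ⌜ p ⌝) (Unit-Ψ′ C′ D′ 0#)) isUnit
      }
      where
      open ≡-Reasoning
      m  = p ℕ.^ k
      n  = p ℕ.^ suc k
      N  = ⌜ n ⌝
      C₀ = C ℕ.* m
      D₀ = D ℕ.* m
      C′ = C ℕ.* n
      D′ = D ℕ.* n
      e  = (p ℕ.^ D₀) ℕ.^ C₀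
      open Content (content C₀ D₀)

      N* : N * w ≡ ⌜ p ⌝ * (⌜ m ⌝ * w)
      N* = trans (cong (_* w) (⌜⌝-* p m)) (*-assoc ⌜ p ⌝ ⌜ m ⌝ w)

      cube : N * N * N ≡ ⌜ p ℕ.^ (3 ℕ.* suc k) ⌝
      cube = begin
        N * N * N     ≡⟨ cong (_* N) (⌜⌝-* n n) ⟨
        ⌜ n ℕ.* n ⌝ * N       ≡⟨ ⌜⌝-* (n ℕ.* n) n ⟨
        ⌜ n ℕ.* n ℕ.* n ⌝         ≡⟨ cong ⌜_⌝ (trans (trans (ℕ.*-assoc n n n) (cong (λ x → n ℕ.* (n ℕ.* x)) (sym (ℕ.*-identityʳ n))))
                                       (trans (ℕ.^-*-assoc p (suc k) 3) (cong (p ℕ.^_) (ℕ.*-comm (suc k) 3)))) ⟩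
        ⌜ p ℕ.^ (3 ℕ.* suc k) ⌝ ∎

      index : ∀ C → C ℕ.* m ℕ.* p ℕ.+ 0 ≡ C ℕ.* n
      index C = trans (ℕ.+-identityʳ _) (trans (ℕ.*-assoc C m p) (cong (C ℕ.*_) (ℕ.*-comm m p)))

      split : ∀ z {z′ x} → ⌜ p ⌝ * z ≡ z′ → Ψ C₀ D₀ z ≡ ⌜ q ⌝ * x →
              Ψ C′ D′ (⌜ p ⌝ * z) ≡ ⌜ e ℕ.* q ⌝ * (Ψ′ p C′ D′ z′ * x)
      split z {x = x} refl eq = begin
        Ψ C′ D′ (⌜ p ⌝ * z)
          ≡⟨ subst₂ (λ C′ D′ → Ψ C′ D′ (⌜ p ⌝ * z) ≡ Ψ′ p C′ D′ (⌜ p ⌝ * z) * (⌜ e ⌝ * Ψ C₀ D₀ z))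
               (index C) (index D) (Ψ-split p C₀ D₀ z (ℕ.>-nonZero⁻¹ p) (ℕ.>-nonZero⁻¹ p)) ⟩
        U * (⌜ e ⌝ * Ψ C₀ D₀ z)
          ≡⟨ cong (λ v → U * (⌜ e ⌝ * v)) eq ⟩
        U * (⌜ e ⌝ * (⌜ q ⌝ * x))
          ≡⟨ solve 4 (λ U e q x → U :* (e :* (q :* x)) := (e :* q) :* (U :* x)) refl U ⌜ e ⌝ ⌜ q ⌝ x ⟩
        (⌜ e ⌝ * ⌜ q ⌝) * (U * x)
          ≡⟨ cong (_* (U * x)) (⌜⌝-* e q) ⟨
        ⌜ e ℕ.* q ⌝ * (U * x) ∎
        where U = Ψ′ p C′ D′ (⌜ p ⌝ * z)

  -- The embedding of ℤ[i] into ℚ(i) and fractions of Gaussian integers.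

  private module ℚi = CommutativeRing ℚ[i]

  fromℤ : ℤ → ℚ
  fromℤ a = a ℚ./ 1

  fromℤ-+ : ∀ a b → fromℤ (a ℤ.+ b) ≡ fromℤ a ℚ.+ fromℤ b
  fromℤ-+ a b = ℚ.toℚᵘ-injective (begin
    ℚ.toℚᵘ (fromℤ (a ℤ.+ b))                     ≈⟨ ℚ.toℚᵘ-fromℚᵘ _ ⟩
    ℚᵘ.mkℚᵘ (a ℤ.+ b) 0                          ≈⟨ ℚᵘ.*≡* (cong (ℤ._* + 1)
                                                      (sym (cong₂ ℤ._+_ (ℤ.*-identityʳ a) (ℤ.*-identityʳ b)))) ⟩
    ℚᵘ.mkℚᵘ a 0 ℚᵘ.+ ℚᵘ.mkℚᵘ b 0                 ≈⟨ ℚᵘ.+-cong (ℚ.toℚᵘ-fromℚᵘ (ℚᵘ.mkℚᵘ a 0)) (ℚ.toℚᵘ-fromℚᵘ (ℚᵘ.mkℚᵘ b 0)) ⟨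
    ℚ.toℚᵘ (fromℤ a) ℚᵘ.+ ℚ.toℚᵘ (fromℤ b)       ≈⟨ ℚ.toℚᵘ-homo-+ (fromℤ a) (fromℤ b) ⟨
    ℚ.toℚᵘ (fromℤ a ℚ.+ fromℤ b)                 ∎)
    where open ℚᵘ.≃-Reasoning

  fromℤ-* : ∀ a b → fromℤ (a ℤ.* b) ≡ fromℤ a ℚ.* fromℤ b
  fromℤ-* a b = ℚ.toℚᵘ-injective (begin
    ℚ.toℚᵘ (fromℤ (a ℤ.* b))                     ≈⟨ ℚ.toℚᵘ-fromℚᵘ _ ⟩
    ℚᵘ.mkℚᵘ a 0 ℚᵘ.* ℚᵘ.mkℚᵘ b 0                 ≈⟨ ℚᵘ.*-cong (ℚ.toℚᵘ-fromℚᵘ (ℚᵘ.mkℚᵘ a 0)) (ℚ.toℚᵘ-fromℚᵘ (ℚᵘ.mkℚᵘ b 0)) ⟨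
    ℚ.toℚᵘ (fromℤ a) ℚᵘ.* ℚ.toℚᵘ (fromℤ b)       ≈⟨ ℚ.toℚᵘ-homo-* (fromℤ a) (fromℤ b) ⟨
    ℚ.toℚᵘ (fromℤ a ℚ.* fromℤ b)                 ∎)
    where open ℚᵘ.≃-Reasoning

  fromℤ-neg : ∀ a → fromℤ (ℤ.- a) ≡ ℚ.- fromℤ a
  fromℤ-neg a = ℚ.toℚᵘ-injective (begin
    ℚ.toℚᵘ (fromℤ (ℤ.- a))    ≈⟨ ℚ.toℚᵘ-fromℚᵘ _ ⟩
    ℚᵘ.- ℚᵘ.mkℚᵘ a 0          ≈⟨ ℚᵘ.-‿cong (ℚ.toℚᵘ-fromℚᵘ (ℚᵘ.mkℚᵘ a 0)) ⟨
    ℚᵘ.- ℚ.toℚᵘ (fromℤ a)     ≈⟨ ℚ.toℚᵘ-homo‿- (fromℤ a) ⟨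
    ℚ.toℚᵘ (ℚ.- fromℤ a)      ∎)
    where open ℚᵘ.≃-Reasoning

  ι : ℤ [i] → ℚ [i]
  ι = map-i fromℤ

  opaque
    unfolding _+_ _*_ -_

    ι-+ : ∀ z w → ι (z + w) ≡ ι z ℚi.+ ι w
    ι-+ z w = cong₂ _+i_ (fromℤ-+ (re z) (re w)) (fromℤ-+ (im z) (im w))

    ι-neg : ∀ z → ι (- z) ≡ ℚi.- ι z
    ι-neg z = cong₂ _+i_ (fromℤ-neg (re z)) (fromℤ-neg (im z))

    ι-* : ∀ z w → ι (z * w) ≡ ι z ℚi.* ι w
    ι-* (a +i b) (c +i d) = cong₂ _+i_
      (trans (fromℤ-+ (a ℤ.* c) (ℤ.- (b ℤ.* d)))
        (cong₂ ℚ._+_ (fromℤ-* a c) (trans (fromℤ-neg (b ℤ.* d)) (cong ℚ.-_ (fromℤ-* b d)))))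
      (trans (fromℤ-+ (a ℤ.* d) (b ℤ.* c)) (cong₂ ℚ._+_ (fromℤ-* a d) (fromℤ-* b c)))

  ι-∏ : ∀ n f → ι (∏ n f) ≡ ℚ⟨i⟩.∏ n (ι ∘ f)
  ι-∏ zero    f = refl
  ι-∏ (suc n) f = trans (ι-* (∏ n f) (f n)) (cong (ℚi._* ι (f n)) (ι-∏ n f))

  ℚ∏-cong : ∀ n {f g} → (∀ j → f j ≡ g j) → ℚ⟨i⟩.∏ n f ≡ ℚ⟨i⟩.∏ n g
  ℚ∏-cong zero    eq = refl
  ℚ∏-cong (suc n) eq = cong₂ ℚi._*_ (ℚ∏-cong n eq) (eq n)

  denominator-Ψ : ∀ C D → denominator C D ≡ ι (Ψ C D 0#)
  denominator-Ψ C D = sym (trans (ι-∏ C _) (ℚ∏-cong C λ x → trans (ι-∏ D _)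
    (ℚ∏-cong D λ y → cong ι (+-identityˡ (gauss (suc x) (suc y))))))

  -- Read backwards, the values A - x with 0 ≤ x < C are (A - C) + x′ with 1 ≤ x′ ≤ C, and likewise
  -- in the other coordinate.
  numerator-Ψ : ∀ {A B C D} → C ≤ A → D ≤ B →
                numerator A B C D ≡ ι (Ψ C D (gauss (A ℕ.∸ C) (B ℕ.∸ D)))
  numerator-Ψ {A} {B} {C} {D} C≤A D≤B = begin
    numerator A B C D
      ≡⟨ trans (ι-∏ C _) (ℚ∏-cong C λ x → trans (ι-∏ D _) (ℚ∏-cong D λ y →
           trans (ι-+ (gauss A B) (- gauss x y)) (cong (ι (gauss A B) ℚi.+_) (ι-neg (gauss x y))))) ⟨
    ι (∏ C λ x → ∏ D λ y → gauss A B - gauss x y)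
      ≡⟨ cong ι (∏-reflect C _ _ λ x x′ ex → ∏-reflect D _ _ λ y y′ ey → lemma x x′ y y′ ex ey) ⟩
    ι (Ψ C D (gauss (A ℕ.∸ C) (B ℕ.∸ D))) ∎
    where
    open ≡-Reasoning
    lemma : ∀ x x′ y y′ → suc (x ℕ.+ x′) ≡ C → suc (y ℕ.+ y′) ≡ D →
            gauss A B - gauss x y ≡ gauss (A ℕ.∸ C) (B ℕ.∸ D) + gauss (suc x′) (suc y′)
    lemma x x′ y y′ ex ey = begin
      gauss A B - gauss x y
        ≡⟨ cong₂ (λ a b → gauss a b - gauss x y) (total ex C≤A) (total ey D≤B) ⟩
      gauss ((A ℕ.∸ C) ℕ.+ suc x′ ℕ.+ x) ((B ℕ.∸ D) ℕ.+ suc y′ ℕ.+ y) - gauss x y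
        ≡⟨ cong (_- gauss x y) (trans (gauss-+ (A ℕ.∸ C ℕ.+ suc x′) x (B ℕ.∸ D ℕ.+ suc y′) y)
             (cong (_+ gauss x y) (gauss-+ (A ℕ.∸ C) (suc x′) (B ℕ.∸ D) (suc y′)))) ⟩
      gauss (A ℕ.∸ C) (B ℕ.∸ D) + gauss (suc x′) (suc y′) + gauss x y - gauss x y
        ≡⟨ solve 2 (λ a b → a :+ b :- b := a) refl _ (gauss x y) ⟩
      gauss (A ℕ.∸ C) (B ℕ.∸ D) + gauss (suc x′) (suc y′) ∎
      where
      total : ∀ {A C x x′} → suc (x ℕ.+ x′) ≡ C → C ≤ A → A ≡ A ℕ.∸ C ℕ.+ suc x′ ℕ.+ x
      total {A} {C} {x} {x′} refl C≤A = sym (trans (ℕ.+-assoc (A ℕ.∸ C) (suc x′) x)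
        (trans (cong (λ m → A ℕ.∸ C ℕ.+ suc m) (ℕ.+-comm x′ x)) (ℕ.m∸n+n≡m C≤A)))

  ÷-* : ∀ z w .{{_ : ℚ.NonZero (ℚ⟨i⟩.norm w)}} → (z ℚ⟨i⟩.÷ w) ℚi.* w ≡ z
  ÷-* z w@(a +i b) = trans (ℚi.*-assoc z _ w) (trans (cong (z ℚi.*_) (cong₂ _+i_
    (trans (solveℚ 3 (λ a b n → a ∙ n ∙ a ⊹ ∸ (∸ b ∙ n ∙ b) ≔ (a ∙ a ⊹ b ∙ b) ∙ n) refl a b n)
           (ℚ.*-inverseʳ (ℚ⟨i⟩.norm w)))
    (solveℚ 3 (λ a b n → a ∙ n ∙ b ⊹ ∸ b ∙ n ∙ a ≔ conℚ ℚ.0ℚ) refl a b n)))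
    (ℚi.*-identityʳ z))
    where
    n = ℚ.1/ ℚ⟨i⟩.norm w
    open ℚ-Solver.+-*-Solver using () renaming
      (solve to solveℚ; con to conℚ; _:=_ to infix 4 _≔_; _:+_ to infixl 6 _⊹_; _:*_ to infixl 7 _∙_; :-_ to infix 8 ∸_)

  -- The rest of the argument uses 𝓡 only through this equation, which avoids division.
  𝓡-denominator : ∀ {A B C D} → C ≤ A → D ≤ B →
    𝓡 A B C D ℚi.* ι (Ψ C D 0#) ≡ ι (Ψ C D (gauss (A ℕ.∸ C) (B ℕ.∸ D)))
  𝓡-denominator {A} {B} {C} {D} C≤A D≤B = begin
    𝓡 A B C D ℚi.* ι (Ψ C D 0#)         ≡⟨ cong (𝓡 A B C D ℚi.*_) (denominator-Ψ C D) ⟨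
    𝓡 A B C D ℚi.* denominator C D      ≡⟨ ÷-* (numerator A B C D) (denominator C D) {{denominator-nonZero C D}} ⟩
    numerator A B C D                   ≡⟨ numerator-Ψ C≤A D≤B ⟩
    ι (Ψ C D (gauss (A ℕ.∸ C) (B ℕ.∸ D))) ∎
    where open ≡-Reasoning

  ι-cancelˡ : ∀ m .{{_ : ℕ.NonZero m}} {z w} → ι ⌜ m ⌝ ℚi.* z ≡ ι ⌜ m ⌝ ℚi.* w → z ≡ w
  ι-cancelˡ m {z} {w} eq = trans (sym (undo z)) (trans (cong (r ℚi.*_) eq) (undo w))
    where
    instance
      m≢0 : ℚ.NonZero (fromℤ (+ m))
      m≢0 = ℚ.pos⇒nonZero (fromℤ (+ m)) {{ℚ.normalize-pos m 1}}

    r : ℚ [i]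
    r = ℚ.1/ fromℤ (+ m) +i ℚ.0ℚ

    inverse : r ℚi.* ι ⌜ m ⌝ ≡ ℚi.1#
    inverse = cong₂ _+i_
      (trans (cong (ℚ._+ ℚ.- (ℚ.0ℚ ℚ.* ℚ.0ℚ)) (ℚ.*-inverseˡ (fromℤ (+ m)))) refl)
      (trans (cong₂ ℚ._+_ (ℚ.*-zeroʳ (ℚ.1/ fromℤ (+ m))) (ℚ.*-zeroˡ (fromℤ (+ m)))) refl)

    undo : ∀ z → r ℚi.* (ι ⌜ m ⌝ ℚi.* z) ≡ z
    undo z = trans (sym (ℚi.*-assoc r (ι ⌜ m ⌝) z)) (trans (cong (ℚi._* z) inverse) (ℚi.*-identityˡ z))

  reduce : ∀ m .{{_ : ℕ.NonZero m}} {x y x′ y′} R → R ℚi.* ι y ≡ ι x →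
           x ≡ ⌜ m ⌝ * x′ → y ≡ ⌜ m ⌝ * y′ → R ℚi.* ι y′ ≡ ι x′
  reduce m {x′ = x′} {y′} R eq refl refl = ι-cancelˡ m (begin
    ι ⌜ m ⌝ ℚi.* (R ℚi.* ι y′)  ≡⟨ x∙yz≈y∙xz (ι ⌜ m ⌝) R (ι y′) ⟩
    R ℚi.* (ι ⌜ m ⌝ ℚi.* ι y′)  ≡⟨ cong (R ℚi.*_) (ι-* ⌜ m ⌝ y′) ⟨
    R ℚi.* ι (⌜ m ⌝ * y′)       ≡⟨ eq ⟩
    ι (⌜ m ⌝ * x′)              ≡⟨ ι-* ⌜ m ⌝ x′ ⟩
    ι ⌜ m ⌝ ℚi.* ι x′           ∎)
    where
    open ≡-Reasoning
    open CommutativeSemigroupProperties ℚi.*-commutativeSemigroup using (x∙yz≈y∙xz)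

  opaque
    unfolding _+_ _*_

    -- The multiplier v is the conjugate of 1 + pt. The resulting norm is a rational integer
    -- congruent to 1 modulo p, so it can be inverted in ℤₚ and acts on each coordinate separately.
    norm-1+p : ∀ p t → Σ[ v ∈ ℤ [i] ] Σ[ b ∈ ℤ ]
               (1# + ⌜ p ⌝ * t) * v ≡ (+ 1 ℤ.+ + p ℤ.* b) +i + 0
    norm-1+p p (a +i b) = ((+ 1 ℤ.+ + p ℤ.* a) +i ℤ.- (+ p ℤ.* b)) ,
      + 2 ℤ.* a ℤ.+ + p ℤ.* (a ℤ.* a ℤ.+ b ℤ.* b) ,
      cong₂ _+i_
        (S.solve 3 (λ p a b →
          (one S.:+ (p S.:* a S.:+ S.:- (nil S.:* b))) S.:* (one S.:+ p S.:* a) S.:+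
          S.:- ((nil S.:+ (p S.:* b S.:+ nil S.:* a)) S.:* S.:- (p S.:* b)) S.:=
          one S.:+ p S.:* (S.con (+ 2) S.:* a S.:+ p S.:* (a S.:* a S.:+ b S.:* b))) refl (+ p) a b)
        (S.solve 3 (λ p a b →
          (one S.:+ (p S.:* a S.:+ S.:- (nil S.:* b))) S.:* S.:- (p S.:* b) S.:+
          (nil S.:+ (p S.:* b S.:+ nil S.:* a)) S.:* (one S.:+ p S.:* a) S.:= nil) refl (+ p) a b)
      where
      one nil : ∀ {n} → S.Polynomial n
      one = S.con (+ 1)
      nil = S.con (+ 0)

    ⌜⌝-*-re : ∀ m z → re (⌜ m ⌝ * z) ≡ + m ℤ.* re z
    ⌜⌝-*-re m z = ℤ.+-identityʳ _

    ⌜⌝-*-im : ∀ m z → im (⌜ m ⌝ * z) ≡ + m ℤ.* im z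
    ⌜⌝-*-im m z = ℤ.+-identityʳ _

  -- The integer ν is a multiple U₂MK of the common denominator of both fractions: R₁ν = U₁x′K and
  -- R₂ν = U₂x′K, and these differ by a multiple of d because U₁ ≡ U₂.
  fraction-congruence : ∀ {p d X Y x y} → CongruentFractions p d X Y x y → ∀ R₁ R₂ →
    R₁ ℚi.* ι Y ≡ ι X → R₂ ℚi.* ι y ≡ ι x →
    Σ[ b ∈ ℤ ] Σ[ g ∈ ℤ [i] ] let ν = ι ((+ 1 ℤ.+ + p ℤ.* b) +i + 0) in
      R₁ ℚi.* ν ≡ R₂ ℚi.* ν ℚi.+ ι (d * g)
  fraction-congruence {p} {d} fractions R₁ R₂ eq₁ eq₂
    with (V , by t WV) ← CongruentFractions.isUnit fractions
    with v , b , uv ← norm-1+p p t = b , c * x′ * K , (begin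
      R₁ ℚi.* ι ((+ 1 ℤ.+ + p ℤ.* b) +i + 0)
        ≡⟨ scale R₁ ⟩
      R₁ ℚi.* ι (U₂ * M) ℚi.* ι K
        ≡⟨ cong (ℚi._* ι K) (reduce s {{s-nonZero}} R₁ eq₁ X≡ Y≡) ⟩
      ι (U₁ * x′) ℚi.* ι K
        ≡⟨ ι-* (U₁ * x′) K ⟨
      ι (U₁ * x′ * K)
        ≡⟨ cong ι (trans (cong (λ U → U * x′ * K) U₁≡)
             (solve 5 (λ U d c x K → (U :+ d :* c) :* x :* K := x :* (U :* K) :+ d :* (c :* x :* K))
               refl U₂ d c x′ K)) ⟩
      ι (x′ * (U₂ * K) + d * (c * x′ * K))
        ≡⟨ ι-+ _ _ ⟩
      ι (x′ * (U₂ * K)) ℚi.+ ι (d * (c * x′ * K))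
        ≡⟨ cong (ℚi._+ ι (d * (c * x′ * K))) (begin
             ι (x′ * (U₂ * K))                ≡⟨ ι-* x′ (U₂ * K) ⟩
             ι x′ ℚi.* ι (U₂ * K)             ≡⟨ cong (ℚi._* ι (U₂ * K)) (reduce q {{q-nonZero}} R₂ eq₂ x≡ y≡) ⟨
             R₂ ℚi.* ι M ℚi.* ι (U₂ * K)      ≡⟨ ℚi.*-assoc R₂ (ι M) (ι (U₂ * K)) ⟩
             R₂ ℚi.* (ι M ℚi.* ι (U₂ * K))    ≡⟨ cong (R₂ ℚi.*_) (trans (sym (ι-* M (U₂ * K))) (trans
                                                   (cong ι (solve 3 (λ M U K → M :* (U :* K) := U :* M :* K) refl M U₂ K))
                                                   (ι-* (U₂ * M) K))) ⟩
             R₂ ℚi.* (ι (U₂ * M) ℚi.* ι K)    ≡⟨ ℚi.*-assoc R₂ (ι (U₂ * M)) (ι K) ⟨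
             R₂ ℚi.* ι (U₂ * M) ℚi.* ι K      ≡⟨ scale R₂ ⟨
             R₂ ℚi.* ι ((+ 1 ℤ.+ + p ℤ.* b) +i + 0) ∎) ⟩
      R₂ ℚi.* ι ((+ 1 ℤ.+ + p ℤ.* b) +i + 0) ℚi.+ ι (d * (c * x′ * K)) ∎)
    where
    open ≡-Reasoning
    open CongruentFractions fractions
    open _≈_mod_ U₁≈U₂ renaming (quotient to c; equality to U₁≡)
    -- V inverts U₂M modulo p, and v is the conjugate that makes U₂MV a rational integer.
    K = V * v

    ν≡ : (+ 1 ℤ.+ + p ℤ.* b) +i + 0 ≡ U₂ * M * K
    ν≡ = trans (sym uv) (trans (cong (_* v) (sym WV)) (*-assoc (U₂ * M) V v))

    scale : ∀ R → R ℚi.* ι ((+ 1 ℤ.+ + p ℤ.* b) +i + 0) ≡ R ℚi.* ι (U₂ * M) ℚi.* ι K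
    scale R = trans (cong (λ z → R ℚi.* ι z) ν≡) (trans (cong (R ℚi.*_) (ι-* (U₂ * M) K))
      (sym (ℚi.*-assoc R (ι (U₂ * M)) (ι K))))

  -- From identities of rationals to congruences in ℤₚ[i].

  fromℤ-injective : ∀ a b → fromℤ a ≡ fromℤ b → a ≡ b
  fromℤ-injective a b eq with ℚᵘ.*≡* e ← ℚ./-injective-≃ (ℚᵘ.mkℚᵘ a 0) (ℚᵘ.mkℚᵘ b 0) eq =
    trans (sym (ℤ.*-identityʳ a)) (trans e (ℤ.*-identityʳ b))

  *-denominator : ∀ q → q ℚ.* fromℤ (↧ q) ≡ fromℤ (↥ q)
  *-denominator q@record{} = ℚ.toℚᵘ-injective (begin
    ℚ.toℚᵘ (q ℚ.* fromℤ (↧ q))             ≈⟨ ℚ.toℚᵘ-homo-* q (fromℤ (↧ q)) ⟩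
    ℚ.toℚᵘ q ℚᵘ.* ℚ.toℚᵘ (fromℤ (↧ q))     ≈⟨ ℚᵘ.*-congˡ {ℚ.toℚᵘ q} (ℚ.toℚᵘ-fromℚᵘ (ℚᵘ.mkℚᵘ (↧ q) 0)) ⟩
    ℚ.toℚᵘ q ℚᵘ.* ℚᵘ.mkℚᵘ (↧ q) 0          ≈⟨ ℚᵘ.*≡* (trans (ℤ.*-identityʳ _) (cong (λ n → ↥ q ℤ.* + n) (sym (ℕ.*-identityʳ _)))) ⟩
    ℚᵘ.mkℚᵘ (↥ q) 0                        ≈⟨ ℚ.toℚᵘ-fromℚᵘ (ℚᵘ.mkℚᵘ (↥ q) 0) ⟨
    ℚ.toℚᵘ (fromℤ (↥ q))                   ∎)
    where open ℚᵘ.≃-Reasoning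

  -- The first factor is the numerator of q₁ - q₂ in the form in which the operations of `ℚₚ`
  -- produce it, without reduction to lowest terms.
  clear-denominators : ∀ q₁ q₂ {ν c} → q₁ ℚ.* fromℤ ν ≡ q₂ ℚ.* fromℤ ν ℚ.+ fromℤ c →
    (↥ q₁ ℤ.* ↧ q₂ ℤ.+ ℤ.- ↥ q₂ ℤ.* ↧ q₁) ℤ.* ν ≡ c ℤ.* (↧ q₁ ℤ.* ↧ q₂)
  clear-denominators q₁ q₂ {ν} {c} eq = begin
    (a ℤ.* e ℤ.+ ℤ.- b ℤ.* d) ℤ.* ν
      ≡⟨ S.solve 5 (λ a b d e ν → (a S.:* e S.:+ S.:- b S.:* d) S.:* ν S.:= (a S.:* e) S.:* ν S.:- (b S.:* d) S.:* ν)
           refl a b d e ν ⟩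
    (a ℤ.* e) ℤ.* ν ℤ.- (b ℤ.* d) ℤ.* ν
      ≡⟨ cong (ℤ._- (b ℤ.* d) ℤ.* ν) (fromℤ-injective (a ℤ.* e ℤ.* ν) (b ℤ.* d ℤ.* ν ℤ.+ c ℤ.* (d ℤ.* e)) (begin
           fromℤ (a ℤ.* e ℤ.* ν)
             ≡⟨ trans (fromℤ-* (a ℤ.* e) ν) (cong (ℚ._* fromℤ ν) (fromℤ-* a e)) ⟩
           fromℤ a ℚ.* fromℤ e ℚ.* fromℤ ν
             ≡⟨ cong (λ x → x ℚ.* fromℤ e ℚ.* fromℤ ν) (*-denominator q₁) ⟨
           q₁ ℚ.* fromℤ d ℚ.* fromℤ e ℚ.* fromℤ ν
             ≡⟨ Q.solve 4 (λ q d e ν → q Q.:* d Q.:* e Q.:* ν Q.:= q Q.:* ν Q.:* (d Q.:* e)) refl q₁ (fromℤ d) (fromℤ e) (fromℤ ν) ⟩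
           q₁ ℚ.* fromℤ ν ℚ.* (fromℤ d ℚ.* fromℤ e)
             ≡⟨ cong (ℚ._* (fromℤ d ℚ.* fromℤ e)) eq ⟩
           (q₂ ℚ.* fromℤ ν ℚ.+ fromℤ c) ℚ.* (fromℤ d ℚ.* fromℤ e)
             ≡⟨ Q.solve 5 (λ q d e ν c → (q Q.:* ν Q.:+ c) Q.:* (d Q.:* e) Q.:=
                  (q Q.:* e) Q.:* d Q.:* ν Q.:+ c Q.:* (d Q.:* e)) refl q₂ (fromℤ d) (fromℤ e) (fromℤ ν) (fromℤ c) ⟩
           q₂ ℚ.* fromℤ e ℚ.* fromℤ d ℚ.* fromℤ ν ℚ.+ fromℤ c ℚ.* (fromℤ d ℚ.* fromℤ e)
             ≡⟨ cong (λ x → x ℚ.* fromℤ d ℚ.* fromℤ ν ℚ.+ fromℤ c ℚ.* (fromℤ d ℚ.* fromℤ e)) (*-denominator q₂) ⟩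
           fromℤ b ℚ.* fromℤ d ℚ.* fromℤ ν ℚ.+ fromℤ c ℚ.* (fromℤ d ℚ.* fromℤ e)
             ≡⟨ cong₂ ℚ._+_ (trans (fromℤ-* (b ℤ.* d) ν) (cong (ℚ._* fromℤ ν) (fromℤ-* b d)))
                  (trans (fromℤ-* c (d ℤ.* e)) (cong (fromℤ c ℚ.*_) (fromℤ-* d e))) ⟨
           fromℤ (b ℤ.* d ℤ.* ν) ℚ.+ fromℤ (c ℤ.* (d ℤ.* e))
             ≡⟨ fromℤ-+ (b ℤ.* d ℤ.* ν) (c ℤ.* (d ℤ.* e)) ⟨
           fromℤ (b ℤ.* d ℤ.* ν ℤ.+ c ℤ.* (d ℤ.* e)) ∎)) ⟩
    b ℤ.* d ℤ.* ν ℤ.+ c ℤ.* (d ℤ.* e) ℤ.- (b ℤ.* d) ℤ.* ν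
      ≡⟨ S.solve 2 (λ x y → x S.:+ y S.:- x S.:= y) refl (b ℤ.* d ℤ.* ν) (c ℤ.* (d ℤ.* e)) ⟩
    c ℤ.* (d ℤ.* e) ∎
    where
    open ≡-Reasoning
    module Q = ℚ-Solver.+-*-Solver
    a = ↥ q₁
    b = ↥ q₂
    d = ↧ q₁
    e = ↧ q₂

  module _ (p : ℕ) where
    open Padic p
    private module Zₚ = RawRing ℤₚ-rawRing

    -- 1 / (1 + p b) = ∑ (- p b)ʲ
    geometric : ℤ → ℕ → ℤ
    geometric b zero    = + 0
    geometric b (suc n) = geometric b n ℤ.+ + (p ℕ.^ n) ℤ.* (ℤ.- b) ℤ.^ n

    geometric-inverse : ∀ b n → (+ 1 ℤ.+ + p ℤ.* b) ℤ.* geometric b n ≡ + 1 ℤ.- + (p ℕ.^ n) ℤ.* (ℤ.- b) ℤ.^ n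
    geometric-inverse b zero    = ℤ.*-zeroʳ (+ 1 ℤ.+ + p ℤ.* b)
    geometric-inverse b (suc n) = begin
      ν ℤ.* (geometric b n ℤ.+ P ℤ.* B)
        ≡⟨ ℤ.*-distribˡ-+ ν (geometric b n) (P ℤ.* B) ⟩
      ν ℤ.* geometric b n ℤ.+ ν ℤ.* (P ℤ.* B)
        ≡⟨ cong (ℤ._+ ν ℤ.* (P ℤ.* B)) (geometric-inverse b n) ⟩
      + 1 ℤ.- P ℤ.* B ℤ.+ ν ℤ.* (P ℤ.* B)
        ≡⟨ S.solve 4 (λ p b P B → S.con (+ 1) S.:- P S.:* B S.:+ (S.con (+ 1) S.:+ p S.:* b) S.:* (P S.:* B) S.:=
             S.con (+ 1) S.:- p S.:* P S.:* (S.:- b S.:* B)) refl (+ p) b P B ⟩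
      + 1 ℤ.- + p ℤ.* P ℤ.* (ℤ.- b ℤ.* B)
        ≡⟨ cong (λ x → + 1 ℤ.- x ℤ.* (ℤ.- b ℤ.* B)) (ℤ.pos-* p (p ℕ.^ n)) ⟨
      + 1 ℤ.- + (p ℕ.^ suc n) ℤ.* (ℤ.- b ℤ.* B) ∎
      where
      open ≡-Reasoning
      ν = + 1 ℤ.+ + p ℤ.* b
      P = + (p ℕ.^ n)
      B = (ℤ.- b) ℤ.^ n

    1/[1+p*_] : ℤ → ℤₚ
    1/[1+p* b ] = mkℤₚ (geometric b) λ n → ℤ∣.divides ((ℤ.- b) ℤ.^ n)
      (S.solve 3 (λ g P B → g S.:+ P S.:* B S.:- g S.:= B S.:* P) refl (geometric b n) (+ (p ℕ.^ n)) ((ℤ.- b) ℤ.^ n))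

    -- For the numerator x of q₁ - q₂ over the denominator d, xν = Pcd holds exactly in ℤ, and the
    -- truncated geometric series inverts ν modulo pⁿ.
    residue-difference : ∀ q₁ q₂ {b c} (P : ℤ) → let ν = + 1 ℤ.+ + p ℤ.* b in
      q₁ ℚ.* fromℤ ν ≡ q₂ ℚ.* fromℤ ν ℚ.+ fromℤ (P ℤ.* c) → ∀ n →
      + (p ℕ.^ n) ℤ∣.∣ (↥ q₁ ℤ.* ↧ q₂ ℤ.+ ℤ.- ↥ q₂ ℤ.* ↧ q₁)
                     ℤ.- P ℤ.* (c ℤ.* geometric b n) ℤ.* (↧ q₁ ℤ.* ↧ q₂)
    residue-difference q₁ q₂ {b} {c} P eq n = ℤ∣.divides (x ℤ.* B) (begin
      x ℤ.- P ℤ.* (c ℤ.* g) ℤ.* d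
        ≡⟨ S.solve 5 (λ x P c g d → x S.:- P S.:* (c S.:* g) S.:* d S.:= x S.:- P S.:* c S.:* d S.:* g) refl x P c g d ⟩
      x ℤ.- P ℤ.* c ℤ.* d ℤ.* g
        ≡⟨ cong (λ y → x ℤ.- y ℤ.* g) (clear-denominators q₁ q₂ {ν} {P ℤ.* c} eq) ⟨
      x ℤ.- x ℤ.* ν ℤ.* g
        ≡⟨ cong (ℤ._-_ x) (trans (ℤ.*-assoc x ν g) (cong (x ℤ.*_) (geometric-inverse b n))) ⟩
      x ℤ.- x ℤ.* (+ 1 ℤ.- Pₙ ℤ.* B)
        ≡⟨ S.solve 3 (λ x P B → x S.:- x S.:* (S.con (+ 1) S.:- P S.:* B) S.:= x S.:* B S.:* P) refl x Pₙ B ⟩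
      x ℤ.* B ℤ.* Pₙ ∎)
      where
      open ≡-Reasoning
      x  = ↥ q₁ ℤ.* ↧ q₂ ℤ.+ ℤ.- ↥ q₂ ℤ.* ↧ q₁
      d  = ↧ q₁ ℤ.* ↧ q₂
      g  = geometric b n
      ν  = + 1 ℤ.+ + p ℤ.* b
      B  = (ℤ.- b) ℤ.^ n
      Pₙ = + (p ℕ.^ n)

    -- The witness is g/ν. As ν is a rational integer, real and imaginary parts can be treated
    -- separately.
    ≡[mod-p^]-intro : ∀ r R₁ R₂ b g → let ν = ι ((+ 1 ℤ.+ + p ℤ.* b) +i + 0) in
      R₁ ℚi.* ν ≡ R₂ ℚi.* ν ℚi.+ ι (⌜ p ℕ.^ r ⌝ * g) → R₁ ≡ R₂ [mod-p^ r ]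
    ≡[mod-p^]-intro r R₁ R₂ b g eq =
      ((ℤ→ℤₚ (re g) Zₚ.* 1/[1+p* b ]) +i (ℤ→ℤₚ (im g) Zₚ.* 1/[1+p* b ])) ,
      (λ n → subst (+ (p ℕ.^ n) ℤ∣.∣_) (re-residue n) (residue-difference (re R₁) (re R₂) P re-eq n)) ,
      (λ n → subst (+ (p ℕ.^ n) ℤ∣.∣_) (im-residue n) (residue-difference (im R₁) (im R₂) P im-eq n))
      where
      P = + (p ℕ.^ r)
      ν = fromℤ (+ 1 ℤ.+ + p ℤ.* b)
      module Q = ℚ-Solver.+-*-Solver

      re-* : ∀ R → re (R ℚi.* (ν +i ℚ.0ℚ)) ≡ re R ℚ.* ν
      re-* R = Q.solve 3 (λ x y ν → x Q.:* ν Q.:+ Q.:- (y Q.:* Q.con ℚ.0ℚ) Q.:= x Q.:* ν) refl (re R) (im R) ν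

      im-* : ∀ R → im (R ℚi.* (ν +i ℚ.0ℚ)) ≡ im R ℚ.* ν
      im-* R = Q.solve 3 (λ x y ν → x Q.:* Q.con ℚ.0ℚ Q.:+ y Q.:* ν Q.:= y Q.:* ν) refl (re R) (im R) ν

      re-eq : re R₁ ℚ.* ν ≡ re R₂ ℚ.* ν ℚ.+ fromℤ (P ℤ.* re g)
      re-eq = trans (sym (re-* R₁)) (trans (cong re eq) (cong₂ ℚ._+_ (re-* R₂) (cong fromℤ (⌜⌝-*-re (p ℕ.^ r) g))))

      im-eq : im R₁ ℚ.* ν ≡ im R₂ ℚ.* ν ℚ.+ fromℤ (P ℤ.* im g)
      im-eq = trans (sym (im-* R₁)) (trans (cong im eq) (cong₂ ℚ._+_ (im-* R₂) (cong fromℤ (⌜⌝-*-im (p ℕ.^ r) g))))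

      denominators : ∀ q₁ q₂ → ↧ q₁ ℤ.* ↧ q₂ ≡ + suc (ℕ.pred (ℚ.↧ₙ q₁ ℕ.* ℚ.↧ₙ q₂))
      denominators q₁ q₂ = sym (ℤ.pos-* (ℚ.↧ₙ q₁) (ℚ.↧ₙ q₂))

      -- The constants 1 and 0 in the solved identity are the denominator of an element of ℤₚ and
      -- the imaginary part of pʳ.
      re-residue : ∀ n → _ ≡ _
      re-residue n = trans (cong (λ d → x ℤ.- P ℤ.* (re g ℤ.* geometric b n) ℤ.* d) (denominators (re R₁) (re R₂)))
        (S.solve 5 (λ x P z z′ d → x S.:- P S.:* z S.:* d S.:=
          x S.:* S.con (+ 1) S.:- (P S.:* z S.:+ S.:- (S.con (+ 0) S.:* z′)) S.:* d) refl
          x P (re g ℤ.* geometric b n) (im g ℤ.* geometric b n) _)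
        where x = ↥ re R₁ ℤ.* ↧ re R₂ ℤ.+ ℤ.- ↥ re R₂ ℤ.* ↧ re R₁

      im-residue : ∀ n → _ ≡ _
      im-residue n = trans (cong (λ d → x ℤ.- P ℤ.* (im g ℤ.* geometric b n) ℤ.* d) (denominators (im R₁) (im R₂)))
        (S.solve 5 (λ x P z z′ d → x S.:- P S.:* z′ S.:* d S.:=
          x S.:* S.con (+ 1) S.:- (P S.:* z′ S.:+ S.con (+ 0) S.:* z) S.:* d) refl
          x P (re g ℤ.* geometric b n) (im g ℤ.* geometric b n) _)
        where x = ↥ im R₁ ℤ.* ↧ im R₂ ℤ.+ ℤ.- ↥ im R₂ ℤ.* ↧ im R₁

  -- Indexing by k + 1 avoids a predecessor. Both levels share w = (A - C) + i(B - D): multiplying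
  -- A, B, C and D by m multiplies the offset of the numerator by m.
  supercongruence : ∀ {p} → Prime p → 5 < p → p ℕ.% 4 ≡ 3 → ∀ k {A B C D} → C ≤ A → D ≤ B →
    let open Padic p ; m = p ℕ.^ k ; n = p ℕ.^ suc k in
    𝓡 (n ℕ.* A) (n ℕ.* B) (n ℕ.* C) (n ℕ.* D) ≡ 𝓡 (m ℕ.* A) (m ℕ.* B) (m ℕ.* C) (m ℕ.* D) [mod-p^ 3 ℕ.* suc k ]
  supercongruence {p} pr 5<p p%4≡3 k {A} {B} {C} {D} C≤A D≤B =
    let b , g , eq = fraction-congruence
          (Ψ-congruentFractions pr 5<p p%4≡3 k C D w)
          (𝓡 (n ℕ.* A) (n ℕ.* B) (n ℕ.* C) (n ℕ.* D)) (𝓡 (m ℕ.* A) (m ℕ.* B) (m ℕ.* C) (m ℕ.* D))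
          (scaled n) (scaled m)
    in ≡[mod-p^]-intro p (3 ℕ.* suc k)
         (𝓡 (n ℕ.* A) (n ℕ.* B) (n ℕ.* C) (n ℕ.* D)) (𝓡 (m ℕ.* A) (m ℕ.* B) (m ℕ.* C) (m ℕ.* D)) b g eq
    where
    open ≡-Reasoning
    m = p ℕ.^ k
    n = p ℕ.^ suc k
    w = gauss (A ℕ.∸ C) (B ℕ.∸ D)

    scaled : ∀ m → 𝓡 (m ℕ.* A) (m ℕ.* B) (m ℕ.* C) (m ℕ.* D) ℚi.* ι (Ψ (C ℕ.* m) (D ℕ.* m) 0#) ≡
                   ι (Ψ (C ℕ.* m) (D ℕ.* m) (⌜ m ⌝ * w))
    scaled m = begin
      R ℚi.* ι (Ψ (C ℕ.* m) (D ℕ.* m) 0#)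
        ≡⟨ cong₂ (λ C D → R ℚi.* ι (Ψ C D 0#)) (ℕ.*-comm C m) (ℕ.*-comm D m) ⟩
      R ℚi.* ι (Ψ (m ℕ.* C) (m ℕ.* D) 0#)
        ≡⟨ 𝓡-denominator (ℕ.*-monoʳ-≤ m C≤A) (ℕ.*-monoʳ-≤ m D≤B) ⟩
      ι (Ψ (m ℕ.* C) (m ℕ.* D) (gauss (m ℕ.* A ℕ.∸ m ℕ.* C) (m ℕ.* B ℕ.∸ m ℕ.* D)))
        ≡⟨ cong (λ z → ι (Ψ (m ℕ.* C) (m ℕ.* D) z)) (trans
             (cong₂ gauss (factor A C) (factor B D)) (gauss-scale m (A ℕ.∸ C) (B ℕ.∸ D))) ⟩
      ι (Ψ (m ℕ.* C) (m ℕ.* D) (⌜ m ⌝ * w))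
        ≡⟨ cong₂ (λ C D → ι (Ψ C D (⌜ m ⌝ * w))) (ℕ.*-comm m C) (ℕ.*-comm m D) ⟩
      ι (Ψ (C ℕ.* m) (D ℕ.* m) (⌜ m ⌝ * w)) ∎
      where
      R = 𝓡 (m ℕ.* A) (m ℕ.* B) (m ℕ.* C) (m ℕ.* D)
      factor : ∀ A C → m ℕ.* A ℕ.∸ m ℕ.* C ≡ (A ℕ.∸ C) ℕ.* m
      factor A C = trans (sym (ℕ.*-distribˡ-∸ m A C)) (ℕ.*-comm m (A ℕ.∸ C))

open import Data.Nat.Base using (_*_; _∸_; _^_; _%_)

theorem1p2 : (p : ℕ) → Prime p → 5 < p → p % 4 ≡ 3 →
    (k : ℕ) → 1 ≤ k →
    (A B C D : ℕ) → 1 ≤ C → C ≤ A → 1 ≤ D → D ≤ B →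
    let open Padic p in
    𝓡 (p ^ k * A) (p ^ k * B) (p ^ k * C) (p ^ k * D)
    ≡ 𝓡 (p ^ (k ∸ 1) * A) (p ^ (k ∸ 1) * B) (p ^ (k ∸ 1) * C) (p ^ (k ∸ 1) * D)
    [mod-p^ 3 * k ]
theorem1p2 p p-prime 5<p p%4≡3 (suc k) _ A B C D _ C≤A _ D≤B =
  Gaussian.supercongruence p-prime 5<p p%4≡3 k C≤A D≤B
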